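{- Let $w$ be a permutation avoiding the pattern $1423$ and let $u$ be a subword of $w$. Then \[\sum_{u\le v\le w}(-1)^{|w|-|v|}\,\Upsilon_{\mathrm{perm}(v)}(\beta)\in\mathbb{Z}_{\ge0}[\beta],\] where the sum is over all subwords $v$ of $w$ that contain $u$ as a subword.
   Context: For $n\ge 0$, $S_n$ is the set of permutations of $\{1,\dots,n\}$, written in one-line notation $w=w(1)\cdots w(n)$; $S_0=\{\emptyset\}$. A word is a finite sequence of distinct positive integers; $|u|$ denotes its length. A subword of a word $v=v(1)\cdots v(n)$ is a word $v(i_1)\cdots v(i_m)$ with $1\le i_1<\cdots<i_m\le n$ (including the empty word); write $u\le v$ if $u$ is a subword of $v$. For a word $u$, $\mathrm{perm}(u)$ is the permutation whose entries are in the same relative order as $u$ (e.g. $\mathrm{perm}(2574)=1342$), $\mathrm{perm}(\emptyset)=\emptyset$. A permutation $w$ avoids $1423$ if there are no indices $i_1<i_2<i_3<i_4$ with $\mathrm{perm}(w(i_1)w(i_2)w(i_3)w(i_4))=1423$. For $w\in S_n$ the $\beta$-Grothendieck polynomial $\mathfrak{G}^{(\beta)}_w(x)\in\mathbb{Z}[\beta][x_1,\dots,x_n]$ is defined by $\mathfrak{G}^{(\beta)}_{w_0}=x_1^{n-1}x_2^{n-2}\cdots x_{n-1}$ for $w_0=n\cdots 21$, and $\mathfrak{G}^{(\beta)}_w=\pi_i\,\mathfrak{G}^{(\beta)}_{ws_i}$ whenever $w(i)<w(i+1)$, where $ws_i$ is $w$ with the entries in positions $i,i+1$ swapped, $\pi_i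 f=\partial_i\big((1+\beta x_{i+1})f\big)$, and $\partial_i f=\frac{f-s_i f}{x_i-x_{i+1}}$ with $s_i f$ the polynomial $f$ with $x_i,x_{i+1}$ interchanged (independent of the choice of $i$). Define $\Upsilon_w(\beta)=\mathfrak{G}^{(\beta)}_w(1,\dots,1)$, with $\Upsilon_\emptyset(\beta)=1$. -}

module Defs where

open import Data.Bool using (Bool; true; false; if_then_else_)
open import Data.Nat as ℕ using (ℕ; zero; suc; _∸_; _<_; _<ᵇ_)
open import Data.Nat.Properties using (_≟_)
open import Data.Integer as ℤ using (ℤ; +_; -1ℤ; _≤_)
open import Data.List using (List; []; _∷_; _++_; map; length; filter; concatMap; upTo; downFrom; foldr; sum)
open import Data.Maybe using (Maybe; just; nothing)
open import Data.Product using (_×_; _,_; proj₁; proj₂)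
open import Relation.Nullary.Decidable using (does)
open import Relation.Binary.PropositionalEquality using (_≡_)
open import Data.List.Relation.Binary.Permutation.Propositional using (_↭_)
open import Data.List.Relation.Binary.Sublist.DecPropositional _≟_ public
  using (_⊆_; _⊆?_)

-- Words and permutations (one-line notation) are lists of positive naturals.
Word : Set
Word = List ℕ

IsPerm : ℕ → Word → Set
IsPerm n w = w ↭ map suc (upTo n)

_≤w_ : Word → Word → Set
u ≤w v = u ⊆ v

perm : Word → Word
perm u = map (λ x → suc (length (filter (λ y → y ℕ.<? x) u))) u

Avoids1423 : Word → Set
Avoids1423 w = ∀ a b c d → (a ∷ b ∷ c ∷ d ∷ []) ⊆ w →
  perm (a ∷ b ∷ c ∷ d ∷ []) ≡ (1 ∷ 4 ∷ 2 ∷ 3 ∷ []) → Data.Empty.⊥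
  where import Data.Empty

-- Polynomials in ℤ[β][x₁,x₂,…] as formal sums of terms
-- c · β^b · x₁^(e₀) x₂^(e₁) …   (missing exponents are 0)

record Term : Set where
  constructor term
  field
    coef  : ℤ
    bexp  : ℕ
    xexps : List ℕ
open Term public

Poly : Set
Poly = List Term

expAt : ℕ → List ℕ → ℕ
expAt i       []       = 0
expAt zero    (e ∷ es) = e
expAt (suc i) (e ∷ es) = expAt i es

setAt : ℕ → ℕ → List ℕ → List ℕ
setAt zero    a []       = a ∷ []
setAt zero    a (e ∷ es) = a ∷ es
setAt (suc i) a []       = 0 ∷ setAt i a []
setAt (suc i) a (e ∷ es) = e ∷ setAt i a es

setPair : ℕ → ℕ → ℕ → List ℕ → List ℕ
setPair i a b es = setAt (suc i) b (setAt i a es)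

-- multiplication by (1 + β x_{i+2}), i 0-based  (i.e. 1 + β x_{j+1} for j = i+1 1-based)
mulOneBeta : ℕ → Poly → Poly
mulOneBeta i p = p ++ map (λ t → term (coef t) (suc (bexp t))
                                  (setAt (suc i) (suc (expAt (suc i) (xexps t))) (xexps t))) p

-- divided difference ∂ on one term, in the variables x_{i+1}, x_{i+2} (0-based i):
-- (x^a y^b − x^b y^a)/(x − y) = Σ_{k<a−b} x^{a−1−k} y^{b+k}  if a > b,
--                             = − Σ_{k<b−a} x^{b−1−k} y^{a+k} if a < b, 0 if a = b.
ddTerm : ℕ → Term → Poly
ddTerm i (term c β es) with expAt i es | expAt (suc i) es
... | a | b with b <ᵇ a | a <ᵇ b
...   | true  | _     = map (λ k → term c β (setPair i (a ∸ 1 ∸ k) (b ℕ.+ k) es)) (upTo (a ∸ b))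
...   | false | true  = map (λ k → term (ℤ.- c) β (setPair i (b ∸ 1 ∸ k) (a ℕ.+ k) es)) (upTo (b ∸ a))
...   | false | false = []

dd : ℕ → Poly → Poly
dd i = concatMap (ddTerm i)

piOp : ℕ → Poly → Poly
piOp i f = dd i (mulOneBeta i f)

topPoly : ℕ → Poly
topPoly n = term (+ 1) 0 (downFrom n) ∷ []

firstAscent : Word → Maybe ℕ
firstAscent []           = nothing
firstAscent (x ∷ [])     = nothing
firstAscent (x ∷ y ∷ ws) =
  if x <ᵇ y then just 0 else Data.Maybe.map suc (firstAscent (y ∷ ws))
  where import Data.Maybe

swapAt : ℕ → Word → Word
swapAt zero    (x ∷ y ∷ ws) = y ∷ x ∷ ws
swapAt (suc i) (x ∷ ws)     = x ∷ swapAt i ws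
swapAt _       ws           = ws

-- recursion 𝔊_w = π_i 𝔊_{w s_i} at the first ascent i, down to w₀ (no ascent);
-- the fuel argument bounds the number of steps (at most n(n−1)/2 are needed).
grothFuel : ℕ → ℕ → Word → Poly
grothFuel n zero    w = topPoly n
grothFuel n (suc f) w with firstAscent w
... | nothing = topPoly n
... | just i  = piOp i (grothFuel n f (swapAt i w))

groth : Word → Poly
groth w = grothFuel (length w) (length w ℕ.* length w) w

-- Polynomials in β (formal sums of c·β^b) and Υ

BPoly : Set
BPoly = List (ℤ × ℕ)

evalOnes : Poly → BPoly
evalOnes = map (λ t → coef t , bexp t)

Upsilon : Word → BPoly
Upsilon w = evalOnes (groth w)

coeffB : ℕ → BPoly → ℤ
coeffB k p = sum' (map proj₁ (filter (λ t → proj₂ t ≟ k) p))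
  where
  sum' : List ℤ → ℤ
  sum' = foldr ℤ._+_ (+ 0)

scaleB : ℤ → BPoly → BPoly
scaleB c = map (λ t → c ℤ.* proj₁ t , proj₂ t)

NonNegCoeffs : BPoly → Set
NonNegCoeffs p = ∀ k → + 0 ≤ coeffB k p

masks : ℕ → List (List Bool)
masks zero    = [] ∷ []
masks (suc n) = map (true ∷_) (masks n) ++ map (false ∷_) (masks n)

select : List Bool → Word → Word
select (true  ∷ bs) (x ∷ xs) = x ∷ select bs xs
select (false ∷ bs) (x ∷ xs) = select bs xs
select _            _        = []

-- all subwords of w (one per choice of positions; distinct since entries are distinct)
subwords : Word → List Word
subwords w = map (λ m → select m w) (masks (length w))

altSum : Word → Word → BPoly
altSum u w = concatMap
  (λ v → if does (u ⊆? v)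
           then scaleB (-1ℤ ℤ.^ (length w ∸ length v)) (Upsilon (perm v))
           else [])
  (subwords w)

{-# OPTIONS --safe #-}
module Submission where

-- Write w = α k γ with k its least letter. Scan γ from right to left holding one letter h, at first the last
-- letter of w: a letter o < h releases h and becomes held; a letter o > h in position j either is passed, with
-- weight x_j, or releases h and becomes held, with weight 1 + β x_j. Then 𝔊_w is x₁⋯x_|α| times the weighted sum
-- of 𝔊_{αγ′} over the resulting words γ′ (this removes the first column of the pipe dreams of w). Indeed the
-- polynomials so defined satisfy 𝔊_w = πᵢ 𝔊_{w sᵢ}, by three identities for the three positions of h relative to
-- w(i) < w(i+1).
--
-- At x = (1,1,…), the alternating sum over u ≤ v ≤ w is Υ applied to w with every letter x outside u struck, that
-- is, replaced by the formal difference x − ∅. If no 1423 in w has its 2 struck, then the recursion expresses Υ of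
-- such a word as a combination, with coefficients in ℕ[β], of Υ of shorter words of the same kind: a letter that
-- is moved in the scan is never struck afterwards, so no forbidden 1423 is created.

open import Defs
open import Data.Bool using (Bool; true; false; if_then_else_)
open import Data.Bool.Properties using (T-≡)
open import Data.Empty using (⊥-elim)
open import Data.Integer as ℤ using (ℤ; +_; -1ℤ; 0ℤ; 1ℤ; _+_; _*_; _-_; -_)
open import Data.Integer.Divisibility.Signed as ∣ using (_∣_; divides; ∣⇒∣ᵤ)
import Data.Integer.Properties as ℤₚ
open import Data.Integer.Tactic.RingSolver using (solve-∀)
open import Data.List using (List; []; _∷_; _++_; map; length; filter; reverse; concatMap; upTo; applyUpTo; downFrom)
open import Data.List.Membership.Propositional using (_∈_; _∉_)
open import Data.List.Membership.Propositional.Properties using (∈-++⁺ʳ)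
import Data.List.Properties as Listₚ
open import Data.List.Relation.Binary.Permutation.Propositional using (_↭_; ↭-refl; ↭-sym; ↭-trans; prep; swap; ↭⇒↭ₛ; ↭-reflexive)
open import Data.List.Relation.Binary.Permutation.Propositional.Properties using (↭-length; ∈-resp-↭; All-resp-↭; ++⁺ˡ; ++⁺ʳ; ↭-reverse; filter-↭)
import Data.List.Relation.Binary.Permutation.Setoid.Properties as PermS
open import Data.List.Relation.Binary.Sublist.Propositional as Sublist using ([]; _∷_; _∷ʳ_; minimum; from∈; ⊆-refl; ⊆-trans) renaming (_⊆_ to _⊑_)
import Data.List.Relation.Binary.Sublist.Propositional.Properties as ⊆ₚ
open import Data.List.Relation.Unary.All as All using (All; []; _∷_)
import Data.List.Relation.Unary.All.Properties as Allₚ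
open import Data.List.Relation.Unary.AllPairs as AllPairs using (AllPairs; []; _∷_)
import Data.List.Relation.Unary.AllPairs.Properties as AllPairsₚ
open import Data.List.Relation.Unary.Any using (here; there)
open import Data.List.Relation.Unary.Linked using (Linked; []; [-]; _∷_)
open import Data.List.Relation.Unary.Linked.Properties using (Linked⇒AllPairs)
open import Data.List.Relation.Unary.Unique.Propositional using (Unique)
import Data.List.Relation.Unary.Unique.Propositional.Properties as Uniqueₚ
open import Data.Maybe as Maybe using (just; nothing)
open import Data.Nat as ℕ using (ℕ; zero; suc; _∸_; _≤_; _<_; _<?_; _<ᵇ_)
import Data.Nat.Divisibility as ℕ∣
open import Data.Nat.Properties as ℕₚ using (_≟_)
open import Data.List.Membership.DecPropositional _≟_ using (_∈?_)
open import Data.Product using (_×_; _,_; proj₁; proj₂; ∃-syntax)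
open import Data.Sum using (_⊎_; inj₁; inj₂)
open import Data.Unit using (⊤; tt)
open import Function using (_∘_; case_of_)
open import Function.Bundles using (Equivalence; mk⇔)
open import Relation.Binary.Definitions using (tri<; tri≈; tri>)
open import Relation.Binary.PropositionalEquality using (_≡_; _≢_; refl; sym; trans; cong; cong₂; subst; subst₂; setoid)
open import Relation.Nullary using (¬_; yes; no; does)
open import Relation.Nullary.Decidable using (dec-true; dec-false; does-⇔)

-- The delicate case is a struck least letter `k`: there the scans of γ are summed and γ itself,
-- unscanned, is subtracted, so nonnegativity alone does not pass through the induction. The
-- inequality `excess` does: the scan that exchanges the held letter at every step returns γ
-- unchanged, with constant term 1, and this copy pays for the subtraction.
--
-- The pattern enters at one point. A held `h` that meets a struck `o < h` is released without a
-- choice. In the term where `o` is deleted, the next letter must force the same release, so it must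
-- be below `h` too. A larger letter would give a 312 with struck 1, which `k` completes to a 1423
-- with struck 2.
--
-- The polynomial 𝔊 is compared with the recursion as a function on integer points. An identity
-- multiplied by x_i - x_{i+1} says nothing where these coordinates agree; congruences modulo
-- integers settle those points.

unique-resp-↭ : ∀ {xs ys : List ℕ} → xs ↭ ys → Unique xs → Unique ys
unique-resp-↭ p = PermS.Unique-resp-↭ (setoid ℕ) (↭⇒↭ₛ p)

-- The recursion over arbitrary scalars

-- X j and Y j stand for the multiplications by x_{j+1} and by 1 + β x_{j+1}.
record Scalars : Set₁ where
  infixl 6 _⊕_
  field
    V   : Set
    _⊕_ : V → V → V
    𝟘 𝟙 : V
    X Y : ℕ → V → V

-- Words are reversed in this recursion: the head is the last letter, and the length of the tail is the
-- 0-based position of the head.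
module Slide (A : Scalars) where
  open Scalars A

  -- Applies K to the outcome of every scan with held letter h. The scan runs past the least letter k, but
  -- contributes 0 unless k is held at the end, so that the letters to the left of k stay in place.
  slide : ℕ → (Word → V) → ℕ → Word → V
  slide k K h []      = if does (h ≟ k) then K [] else 𝟘
  slide k K h (o ∷ z) =
    if does (o <? h)
      then slide k (K ∘ (h ∷_)) o z
      else X (length z) (slide k (K ∘ (o ∷_)) h z) ⊕ Y (length z) (slide k (K ∘ (h ∷_)) o z)

  strip : ℕ → (Word → V) → Word → V
  strip k K []      = 𝟘
  strip k K (h ∷ z) = slide k K h z

  -- Meaningful for words with distinct letters in [k, k + n).
  value : ℕ → ℕ → Word → V
  value zero    k z = 𝟙
  value (suc n) k z =
    if does (k ∈? z) then strip k (value n (suc k)) z else value n (suc k) z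

  slide-< : ∀ k K {h o} z → o < h → slide k K h (o ∷ z) ≡ slide k (K ∘ (h ∷_)) o z
  slide-< k K {h} {o} z o<h rewrite dec-true (o <? h) o<h = refl

  slide-≮ : ∀ k K {h o} z → ¬ (o < h) → slide k K h (o ∷ z) ≡
    X (length z) (slide k (K ∘ (o ∷_)) h z) ⊕ Y (length z) (slide k (K ∘ (h ∷_)) o z)
  slide-≮ k K {h} {o} z o≮h rewrite dec-false (o <? h) o≮h = refl

  value-∈ : ∀ n {k z} → k ∈ z → value (suc n) k z ≡ strip k (value n (suc k)) z
  value-∈ n {k} {z} k∈z rewrite dec-true (k ∈? z) k∈z = refl

  value-∉ : ∀ n {k z} → k ∉ z → value (suc n) k z ≡ value n (suc k) z
  value-∉ n {k} {z} k∉z rewrite dec-false (k ∈? z) k∉z = refl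

-- Logical relations between two interpretations of the recursion

module Related (A B : Scalars) (_∼_ : Scalars.V A → Scalars.V B → Set) where
  open Scalars
  module SA = Slide A
  module SB = Slide B

  -- The bound `j < i` lets `Sym i` and `Pi i` qualify: exchanging `x i` and `x (suc i)` fixes the
  -- earlier coordinates.
  record Compatible (i : ℕ) : Set where
    field
      ⊕-rel : ∀ {a b a′ b′} → a ∼ b → a′ ∼ b′ → _⊕_ A a a′ ∼ _⊕_ B b b′
      𝟘-rel : 𝟘 A ∼ 𝟘 B
      X-rel : ∀ {j a b} → j < i → a ∼ b → X A j a ∼ X B j b
      Y-rel : ∀ {j a b} → j < i → a ∼ b → Y A j a ∼ Y B j b

  module _ {i : ℕ} (C : Compatible i) where
    open Compatible C

    -- Parametricity in the scalars. The continuations are compared only on words that a scan of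
    -- `h ∷ z` can produce, which are its rearrangements without `k`.
    slide-rel : ∀ k K K′ h z → length z ℕ.≤ i →
      (∀ z′ → (k ∷ z′) ↭ (h ∷ z) → K z′ ∼ K′ z′) →
      SA.slide k K h z ∼ SB.slide k K′ h z
    slide-rel k K K′ h [] _ hyp with h ≟ k
    ... | yes refl rewrite dec-true (h ≟ h) refl = hyp [] ↭-refl
    ... | no  h≢k rewrite dec-false (h ≟ k) h≢k = 𝟘-rel
    slide-rel k K K′ h (o ∷ z) l hyp with o <? h
    ... | yes o<h rewrite dec-true (o <? h) o<h = slide-rel k (K ∘ (h ∷_)) (K′ ∘ (h ∷_)) o z (ℕₚ.<⇒≤ l)
        (λ z′ p → hyp (h ∷ z′) (↭-trans (swap k h ↭-refl) (prep h p)))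
    ... | no o≮h rewrite dec-false (o <? h) o≮h = ⊕-rel
        (X-rel l (slide-rel k (K ∘ (o ∷_)) (K′ ∘ (o ∷_)) h z (ℕₚ.<⇒≤ l)
          (λ z′ p → hyp (o ∷ z′) (↭-trans (swap k o ↭-refl) (↭-trans (prep o p) (swap o h ↭-refl))))))
        (Y-rel l (slide-rel k (K ∘ (h ∷_)) (K′ ∘ (h ∷_)) o z (ℕₚ.<⇒≤ l)
          (λ z′ p → hyp (h ∷ z′) (↭-trans (swap k h ↭-refl) (prep h p)))))

    -- One letter more than in `slide-rel` is allowed: the last letter of the word is held at the
    -- outset, so its position carries no weight.
    value-rel : 𝟙 A ∼ 𝟙 B → ∀ n k z → length z ℕ.≤ suc i → SA.value n k z ∼ SB.value n k z
    value-rel r zero    k z l = r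
    value-rel r (suc n) k z l with k ∈? z
    ... | no  _ = value-rel r n (suc k) z l
    value-rel r (suc n) k []      l | yes _ = 𝟘-rel
    value-rel r (suc n) k (h ∷ z) l | yes _ =
      slide-rel k _ _ h z (ℕₚ.≤-pred l)
        (λ z′ p → value-rel r n (suc k) z′
          (subst (ℕ._≤ suc i) (sym (ℕₚ.suc-injective (↭-length p))) (ℕₚ.≤-trans (ℕₚ.≤-pred l) (ℕₚ.n≤1+n i))))

-- The recursion satisfies the divided difference equations

swapX : ℕ → (ℕ → ℤ) → ℕ → ℤ
swapX zero    x zero          = x 1
swapX zero    x (suc zero)    = x 0
swapX zero    x (suc (suc j)) = x (suc (suc j))
swapX (suc i) x zero          = x 0
swapX (suc i) x (suc j)       = swapX i (x ∘ suc) j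

swapX-i : ∀ i x → swapX i x i ≡ x (suc i)
swapX-i zero    x = refl
swapX-i (suc i) x = swapX-i i (x ∘ suc)

swapX-1+i : ∀ i x → swapX i x (suc i) ≡ x i
swapX-1+i zero    x = refl
swapX-1+i (suc i) x = swapX-1+i i (x ∘ suc)

swapX-< : ∀ i x {j} → j < i → swapX i x j ≡ x j
swapX-< (suc i) x {zero}  _           = refl
swapX-< (suc i) x {suc j} (ℕ.s≤s j<i) = swapX-< i (x ∘ suc) j<i

swapX-> : ∀ i x {j} → suc i < j → swapX i x j ≡ x j
swapX-> zero    x {suc (suc j)} _           = refl
swapX-> zero    x {suc zero} (ℕ.s≤s ())
swapX-> (suc i) x {suc j}       (ℕ.s≤s i<j) = swapX-> i (x ∘ suc) i<j

functions : ℤ → Scalars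
functions β = record
  { V   = (ℕ → ℤ) → ℤ
  ; _⊕_ = λ f g x → f x + g x
  ; 𝟘   = λ _ → 0ℤ
  ; 𝟙   = λ _ → 1ℤ
  ; X   = λ j f x → x j * f x
  ; Y   = λ j f x → (1ℤ + β * x j) * f x
  }

Within : ℕ → ℕ → ℕ → Set
Within k n y = k ℕ.≤ y × y < k ℕ.+ n

within-suc : ∀ {k n y} → k ≢ y → Within k (suc n) y → Within (suc k) n y
within-suc {k} {n} {y} k≢y (k≤y , y<) = ℕₚ.≤∧≢⇒< k≤y k≢y , subst (y <_) (ℕₚ.+-suc k n) y<

within-∉ : ∀ {k n z} → k ∉ z → All (Within k (suc n)) z → All (Within (suc k) n) z
within-∉ {z = []}    _   []       = []
within-∉ {z = y ∷ z} k∉z (w ∷ ws) = within-suc (λ { refl → k∉z (here refl) }) w ∷ within-∉ (k∉z ∘ there) ws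

unique-∉ : ∀ {k : ℕ} {z} → Unique (k ∷ z) → k ∉ z
unique-∉ (k≢ ∷ _) k∈z = All.lookup k≢ k∈z refl

push : ∀ {k h : ℕ} {z z′} → (k ∷ z′) ↭ z → (k ∷ h ∷ z′) ↭ (h ∷ z)
push {k} {h} p = ↭-trans (swap k h ↭-refl) (prep h p)

push-under : ∀ {k h a : ℕ} {z z′} → (k ∷ z′) ↭ (h ∷ z) → (k ∷ a ∷ z′) ↭ (h ∷ a ∷ z)
push-under {a = a} p = ↭-trans (push p) (swap a _ ↭-refl)

length-swap : ∀ A {p q : ℕ} {B} → length (A ++ q ∷ p ∷ B) ≡ length (A ++ p ∷ q ∷ B)
length-swap []      = refl
length-swap (a ∷ A) = cong suc (length-swap A)

length-after : ∀ A {p q : ℕ} {B} → suc (length B) < length (A ++ q ∷ p ∷ B)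
length-after []      = ℕₚ.≤-refl
length-after (a ∷ A) = ℕₚ.m<n⇒m<1+n (length-after A)

module DividedDifference (β : ℤ) where
  open Scalars (functions β)
  open Slide (functions β)

  Sym : ℕ → V → V → Set
  Sym i f g = ∀ x → f (swapX i x) ≡ g x

  -- The equation upper = πᵢ lower with its denominator cleared, because the two coordinates of an
  -- integer point may coincide.
  Cleared : ℕ → V → V → Set
  Cleared i upper lower = ∀ x → (x i - x (suc i)) * upper x ≡
    (1ℤ + β * x (suc i)) * lower x - (1ℤ + β * x i) * lower (swapX i x)

  -- upper = πᵢ lower. The symmetry of upper follows from step for polynomials only, where x i - x (suc i)
  -- can be cancelled.
  record Pi (i : ℕ) (upper lower : V) : Set where
    constructor pi
    field
      symm : Sym i upper upper
      step : Cleared i upper lower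
  open Pi

  open Related.Compatible

  pi-scale : ∀ {i u l} (c : V) → Sym i c c → Pi i u l → Pi i (λ x → c x * u x) (λ x → c x * l x)
  pi-scale {i} {u} {l} c c-sym (pi s e) =
    pi (λ x → cong₂ _*_ (c-sym x) (s x)) λ x →
      trans (swap-factors (x i - x (suc i)) (c x) (u x))
      (trans (cong (c x *_) (e x))
      (trans (distribute (c x) (1ℤ + β * x (suc i)) (1ℤ + β * x i) (l x) (l (swapX i x)))
      (cong (λ t → (1ℤ + β * x (suc i)) * (c x * l x) - (1ℤ + β * x i) * (t * l (swapX i x))) (sym (c-sym x)))))
    where
    swap-factors : ∀ w c a → w * (c * a) ≡ c * (w * a)
    swap-factors = solve-∀
    distribute : ∀ c u v p q → c * (u * p - v * q) ≡ u * (c * p) - v * (c * q)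
    distribute = solve-∀

  pi-⊕ : ∀ {i u l u′ l′} → Pi i u l → Pi i u′ l′ → Pi i (u ⊕ u′) (l ⊕ l′)
  pi-⊕ {i} {u} {l} {u′} {l′} (pi s e) (pi s′ e′) =
    pi (λ x → cong₂ _+_ (s x) (s′ x)) λ x →
      trans (ℤₚ.*-distribˡ-+ (x i - x (suc i)) (u x) (u′ x))
      (trans (cong₂ _+_ (e x) (e′ x))
        (collect (1ℤ + β * x (suc i)) (1ℤ + β * x i) (l x) (l (swapX i x)) (l′ x) (l′ (swapX i x))))
    where
    collect : ∀ u v p q r s → (u * p - v * q) + (u * r - v * s) ≡ u * (p + r) - v * (q + s)
    collect = solve-∀

  pi-X : ∀ {i j u l} → (∀ x → swapX i x j ≡ x j) → Pi i u l → Pi i (X j u) (X j l)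
  pi-X {j = j} fixed = pi-scale (λ x → x j) fixed

  pi-Y : ∀ {i j u l} → (∀ x → swapX i x j ≡ x j) → Pi i u l → Pi i (Y j u) (Y j l)
  pi-Y {j = j} fixed = pi-scale (λ x → 1ℤ + β * x j) (λ x → cong (λ t → 1ℤ + β * t) (fixed x))

  pi-compatible : ∀ i → Related.Compatible (functions β) (functions β) (Pi i) i
  pi-compatible i .⊕-rel = pi-⊕
  pi-compatible i .𝟘-rel = pi (λ _ → refl) λ x → ring (x i - x (suc i)) (1ℤ + β * x (suc i)) (1ℤ + β * x i)
    where
    ring : ∀ w u v → w * 0ℤ ≡ u * 0ℤ - v * 0ℤ
    ring = solve-∀
  pi-compatible i .X-rel j<i = pi-X (λ x → swapX-< i x j<i)
  pi-compatible i .Y-rel j<i = pi-Y (λ x → swapX-< i x j<i)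

  sym-compatible : ∀ i → Related.Compatible (functions β) (functions β) (Sym i) i
  sym-compatible i .⊕-rel p q x = cong₂ _+_ (p x) (q x)
  sym-compatible i .𝟘-rel x = refl
  sym-compatible i .X-rel j<i p x = cong₂ _*_ (swapX-< i x j<i) (p x)
  sym-compatible i .Y-rel j<i p x = cong₂ _*_ (cong (λ t → 1ℤ + β * t) (swapX-< i x j<i)) (p x)

  private
    -- The exchange identities are linear combinations of their hypotheses. Each ring equation
    -- carries a hypothesis as a multiple of its left side minus its right side, and `absorb` makes
    -- that multiple vanish.
    absorb : ∀ {l r} c → l ≡ r → c * (l - r) ≡ 0ℤ
    absorb {l} c refl = ring c l
      where
      ring : ∀ c l → c * (l - l) ≡ 0ℤ
      ring = solve-∀

    drop₁ : ∀ {r a} → a ≡ 0ℤ → r + a ≡ r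
    drop₁ {r} refl = ℤₚ.+-identityʳ r

    drop₃ : ∀ {r a b c} → a ≡ 0ℤ → b ≡ 0ℤ → c ≡ 0ℤ → r + (a + b + c) ≡ r
    drop₃ {r} refl refl refl = ℤₚ.+-identityʳ r

  -- The letters p < q are swapped under a held letter h; here h < p < q.
  pi-hold-low : ∀ {i u₁ l₁ u₂ l₂ u₃ l₃} → Pi i u₁ l₁ → Pi i u₂ l₂ → Pi i u₃ l₃ →
    Pi i (X (suc i) (X i u₁ ⊕ Y i u₃) ⊕ Y (suc i) l₃)
         (X (suc i) (X i l₁ ⊕ Y i u₂) ⊕ Y (suc i) (X i l₃ ⊕ Y i l₂))
  pi-hold-low {i} {u₁} {l₁} {u₂} {l₂} {u₃} {l₃} (pi s₁ e₁) (pi s₂ e₂) (pi s₃ e₃) = pi symm′ step′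
    where
    ring-symm : ∀ a b β u₁ u₃ l₃ g₃ →
      a * (b * u₁ + (1ℤ + β * b) * u₃) + (1ℤ + β * a) * g₃
        ≡ (b * (a * u₁ + (1ℤ + β * a) * u₃) + (1ℤ + β * b) * l₃)
          + 1ℤ * ((a - b) * u₃ - ((1ℤ + β * b) * l₃ - (1ℤ + β * a) * g₃))
    ring-symm = solve-∀
    ring-step : ∀ a b β u₁ l₁ g₁ u₂ l₂ g₂ u₃ l₃ g₃ →
      (a - b) * (b * (a * u₁ + (1ℤ + β * a) * u₃) + (1ℤ + β * b) * l₃)
        ≡ ((1ℤ + β * b) * (b * (a * l₁ + (1ℤ + β * a) * u₂) + (1ℤ + β * b) * (a * l₃ + (1ℤ + β * a) * l₂))
           - (1ℤ + β * a) * (a * (b * g₁ + (1ℤ + β * b) * u₂) + (1ℤ + β * a) * (b * g₃ + (1ℤ + β * b) * g₂)))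
          + (a * b * ((a - b) * u₁ - ((1ℤ + β * b) * l₁ - (1ℤ + β * a) * g₁))
           + (1ℤ + β * a) * (1ℤ + β * b) * ((a - b) * u₂ - ((1ℤ + β * b) * l₂ - (1ℤ + β * a) * g₂))
           + b * (1ℤ + β * a) * ((a - b) * u₃ - ((1ℤ + β * b) * l₃ - (1ℤ + β * a) * g₃)))
    ring-step = solve-∀
    U = X (suc i) (X i u₁ ⊕ Y i u₃) ⊕ Y (suc i) l₃
    L = X (suc i) (X i l₁ ⊕ Y i u₂) ⊕ Y (suc i) (X i l₃ ⊕ Y i l₂)
    symm′ : Sym i U U
    symm′ x rewrite swapX-i i x | swapX-1+i i x | s₁ x | s₃ x =
      trans (ring-symm (x i) (x (suc i)) β (u₁ x) (u₃ x) (l₃ x) (l₃ (swapX i x))) (drop₁ (absorb 1ℤ (e₃ x)))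
    step′ : Cleared i U L
    step′ x rewrite swapX-i i x | swapX-1+i i x | s₂ x =
      trans (ring-step (x i) (x (suc i)) β (u₁ x) (l₁ x) (l₁ (swapX i x)) (u₂ x) (l₂ x) (l₂ (swapX i x))
                       (u₃ x) (l₃ x) (l₃ (swapX i x)))
            (drop₃ (absorb (x i * x (suc i)) (e₁ x))
                   (absorb ((1ℤ + β * x i) * (1ℤ + β * x (suc i))) (e₂ x))
                   (absorb (x (suc i) * (1ℤ + β * x i)) (e₃ x)))

  -- p < h < q
  pi-hold-mid : ∀ {i u l v} → Pi i u l → Sym i v v →
    Pi i (X (suc i) u ⊕ Y (suc i) l) (X i l ⊕ Y i v)
  pi-hold-mid {i} {u} {l} {v} (pi s e) v-sym = pi symm′ step′
    where
    ring-symm : ∀ a b β u l g →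
      a * u + (1ℤ + β * a) * g ≡ (b * u + (1ℤ + β * b) * l)
        + 1ℤ * ((a - b) * u - ((1ℤ + β * b) * l - (1ℤ + β * a) * g))
    ring-symm = solve-∀
    ring-step : ∀ a b β u l g v →
      (a - b) * (b * u + (1ℤ + β * b) * l)
        ≡ ((1ℤ + β * b) * (a * l + (1ℤ + β * a) * v) - (1ℤ + β * a) * (b * g + (1ℤ + β * b) * v))
          + b * ((a - b) * u - ((1ℤ + β * b) * l - (1ℤ + β * a) * g))
    ring-step = solve-∀
    U = X (suc i) u ⊕ Y (suc i) l
    L = X i l ⊕ Y i v
    symm′ : Sym i U U
    symm′ x rewrite swapX-1+i i x | s x =
      trans (ring-symm (x i) (x (suc i)) β (u x) (l x) (l (swapX i x))) (drop₁ (absorb 1ℤ (e x)))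
    step′ : Cleared i U L
    step′ x rewrite swapX-i i x | v-sym x =
      trans (ring-step (x i) (x (suc i)) β (u x) (l x) (l (swapX i x)) (v x)) (drop₁ (absorb (x (suc i)) (e x)))

  -- p < q < h, or no held letter at all
  pi-hold-high : ∀ {i u v} → Sym i u u → Sym i v v → Pi i u (X i u ⊕ Y i v)
  pi-hold-high {i} {u} {v} u-sym v-sym = pi u-sym step′
    where
    ring-step : ∀ a b β u v →
      (a - b) * u ≡ (1ℤ + β * b) * (a * u + (1ℤ + β * a) * v) - (1ℤ + β * a) * (b * u + (1ℤ + β * b) * v)
    ring-step = solve-∀
    step′ : Cleared i u (X i u ⊕ Y i v)
    step′ x rewrite swapX-i i x | u-sym x | v-sym x = ring-step (x i) (x (suc i)) β (u x) (v x)

  -- The scan may exchange `p` or `q` for the held letter, so the letters found afterwards at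
  -- positions i and i+1 can be others. Hence the hypothesis on `K` ranges over all pairs `p′ < q′`
  -- at these positions.
  slide-pi : ∀ k i K h A {p q} B → p < q → length B ≡ i → Unique (h ∷ A ++ q ∷ p ∷ B) →
    (∀ A′ {p′ q′} B′ → p′ < q′ → length B′ ≡ i → (k ∷ A′ ++ q′ ∷ p′ ∷ B′) ↭ (h ∷ A ++ q ∷ p ∷ B) →
       Pi i (K (A′ ++ q′ ∷ p′ ∷ B′)) (K (A′ ++ p′ ∷ q′ ∷ B′))) →
    Pi i (slide k K h (A ++ q ∷ p ∷ B)) (slide k K h (A ++ p ∷ q ∷ B))
  slide-pi k i K h [] {p} {q} B p<q refl ((h≢q ∷ h≢p ∷ _) ∷ _) hyp = by-order (ℕₚ.<-cmp h p) (ℕₚ.<-cmp h q)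
    where
    -- The letters `t`, `s` are left at positions i+1, i and the scan goes on with `g` held. The
    -- indices 1, 2, 3 of `pi-hold-low` are the cases where `g` is `h`, `q`, `p`.
    pair : ∀ {s t g} → s < t → (t ∷ s ∷ g ∷ []) ↭ (h ∷ q ∷ p ∷ []) →
      Pi i (slide k (λ b → K (t ∷ s ∷ b)) g B) (slide k (λ b → K (s ∷ t ∷ b)) g B)
    pair {s} {t} {g} s<t perm = Related.slide-rel _ _ _ (pi-compatible i) k _ _ g B ℕₚ.≤-refl
      λ z′ ρ → hyp [] z′ s<t (ℕₚ.suc-injective (↭-length ρ))
        (↭-trans (push (push ρ)) (++⁺ʳ B perm))
    by-order : _ → _ → Pi i (slide k K h (q ∷ p ∷ B)) (slide k K h (p ∷ q ∷ B))
    by-order (tri< h<p _ _) _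
      rewrite slide-≮ k K (p ∷ B) (ℕₚ.<⇒≯ (ℕₚ.<-trans h<p p<q))
            | slide-≮ k (K ∘ (q ∷_)) B (ℕₚ.<⇒≯ h<p)
            | slide-< k (K ∘ (h ∷_)) B p<q
            | slide-≮ k K (q ∷ B) (ℕₚ.<⇒≯ h<p)
            | slide-≮ k (K ∘ (p ∷_)) B (ℕₚ.<⇒≯ (ℕₚ.<-trans h<p p<q))
            | slide-≮ k (K ∘ (h ∷_)) B (ℕₚ.<⇒≯ p<q)
      = pi-hold-low (pair p<q (↭-trans (prep q (swap p h ↭-refl)) (swap q h ↭-refl)))
                    (pair h<p (↭-trans (swap p h ↭-refl) (prep h (swap p q ↭-refl))))
                    (pair (ℕₚ.<-trans h<p p<q) (swap q h ↭-refl))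
    by-order (tri≈ _ h≡p _) _ = ⊥-elim (h≢p h≡p)
    by-order (tri> _ _ p<h) (tri< h<q _ _)
      rewrite slide-≮ k K (p ∷ B) (ℕₚ.<⇒≯ h<q)
            | slide-< k (K ∘ (q ∷_)) B p<h
            | slide-< k (K ∘ (h ∷_)) B p<q
            | slide-< k K (q ∷ B) p<h
            | slide-≮ k (K ∘ (h ∷_)) B (ℕₚ.<⇒≯ p<q)
      = pi-hold-mid (pair h<q (swap q h ↭-refl)) (pair p<h hpq↭hqp .symm)
      where hpq↭hqp = prep h (swap p q ↭-refl)
    by-order (tri> _ _ p<h) (tri≈ _ h≡q _) = ⊥-elim (h≢q h≡q)
    by-order (tri> _ _ p<h) (tri> _ _ q<h)
      rewrite slide-< k K (p ∷ B) q<h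
            | slide-< k (K ∘ (h ∷_)) B p<q
            | slide-< k K (q ∷ B) p<h
            | slide-≮ k (K ∘ (h ∷_)) B (ℕₚ.<⇒≯ p<q)
      = pi-hold-high (pair q<h ↭-refl .symm) (pair p<h (prep h (swap p q ↭-refl)) .symm)
  slide-pi k i K h (a ∷ A) {p} {q} B p<q refl u hyp with a <? h
  ... | yes a<h rewrite dec-true (a <? h) a<h =
    slide-pi k i (K ∘ (h ∷_)) a A B p<q refl (AllPairs.tail u) (λ A′ B′ p′<q′ l ρ → hyp (h ∷ A′) B′ p′<q′ l (push ρ))
  ... | no a≮h rewrite dec-false (a <? h) a≮h | sym (length-swap A {p} {q} {B}) =
    pi-⊕ (pi-X fixed (slide-pi k i (K ∘ (a ∷_)) h A B p<q refl (AllPairs.tail (unique-resp-↭ (swap h a ↭-refl) u))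
            (λ A′ B′ p′<q′ l ρ → hyp (a ∷ A′) B′ p′<q′ l (push-under ρ))))
         (pi-Y fixed (slide-pi k i (K ∘ (h ∷_)) a A B p<q refl (AllPairs.tail u)
            (λ A′ B′ p′<q′ l ρ → hyp (h ∷ A′) B′ p′<q′ l (push ρ))))
    where
    fixed : ∀ x → swapX i x (length (A ++ q ∷ p ∷ B)) ≡ x (length (A ++ q ∷ p ∷ B))
    fixed x = swapX-> i x (length-after A)

  -- A word of at most i+1 letters puts weights on positions below i only, so neither exchanged
  -- variable occurs.
  value-sym : ∀ n k i z → length z ℕ.≤ suc i → Sym i (value n k z) (value n k z)
  value-sym n k i z = Related.value-rel _ _ _ (sym-compatible i) (λ _ → refl) n k z

  value-pi : ∀ n k A {p q} B → p < q → Unique (A ++ q ∷ p ∷ B) → All (Within k n) (A ++ q ∷ p ∷ B) →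
    Pi (length B) (value n k (A ++ q ∷ p ∷ B)) (value n k (A ++ p ∷ q ∷ B))
  value-pi zero k A {q = q} B p<q u w with Allₚ.++⁻ʳ A w
  ... | (k≤q , q<k+0) ∷ _ = ⊥-elim (ℕₚ.<⇒≱ (subst (q <_) (ℕₚ.+-identityʳ k) q<k+0) k≤q)
  value-pi (suc n) k A {p} {q} B p<q u w with k ∈? (A ++ q ∷ p ∷ B)
  ... | no k∉z rewrite value-∉ n {k} {A ++ p ∷ q ∷ B} (k∉z ∘ ∈-resp-↭ (++⁺ˡ A (swap p q ↭-refl))) =
    value-pi n (suc k) A B p<q u (within-∉ k∉z w)
  ... | yes k∈z rewrite value-∈ n {k} {A ++ p ∷ q ∷ B} (∈-resp-↭ (++⁺ˡ A (swap q p ↭-refl)) k∈z) =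
    at A u w
    where
    i = length B
    K = value n (suc k)
    at : ∀ A → Unique (A ++ q ∷ p ∷ B) → All (Within k (suc n)) (A ++ q ∷ p ∷ B) →
      Pi i (strip k K (A ++ q ∷ p ∷ B)) (strip k K (A ++ p ∷ q ∷ B))
    at [] _ _ rewrite slide-< k K B p<q | slide-≮ k K B (ℕₚ.<⇒≯ p<q) =
      pi-hold-high (slide-sym q p) (slide-sym p q)
      where
      slide-sym : ∀ e h → Sym i (slide k (K ∘ (e ∷_)) h B) (slide k (K ∘ (e ∷_)) h B)
      slide-sym e h = Related.slide-rel _ _ _ (sym-compatible i) k _ _ h B ℕₚ.≤-refl
        λ z′ ρ → value-sym n (suc k) i (e ∷ z′) (ℕₚ.≤-reflexive (↭-length ρ))
    at (a ∷ A) u w = slide-pi k i K a A B p<q refl u λ A′ B′ p′<q′ l ρ →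
      let u′ = unique-resp-↭ (↭-sym ρ) u
          w′ = All-resp-↭ (↭-sym ρ) w
      in subst (λ j → Pi j _ _) l
           (value-pi n (suc k) A′ B′ p′<q′ (AllPairs.tail u′) (within-∉ (unique-∉ u′) (All.tail w′)))

-- Evaluation of formal polynomials and of `piOp`

monomial : (ℕ → ℤ) → List ℕ → ℤ
monomial x []       = 1ℤ
monomial x (e ∷ es) = x 0 ℤ.^ e * monomial (x ∘ suc) es

-- The factor of a monomial without the variables x i and x (suc i).
monomialOff : ℕ → (ℕ → ℤ) → List ℕ → ℤ
monomialOff zero    x []            = 1ℤ
monomialOff zero    x (_ ∷ [])      = 1ℤ
monomialOff zero    x (_ ∷ _ ∷ es)  = monomial (x ∘ suc ∘ suc) es
monomialOff (suc i) x []            = 1ℤ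
monomialOff (suc i) x (e ∷ es)      = x 0 ℤ.^ e * monomialOff i (x ∘ suc) es

front : ∀ a b c d → a * (b * (c * d)) ≡ b * (c * (a * d))
front = solve-∀

monomial-split : ∀ i x es →
  monomial x es ≡ x i ℤ.^ expAt i es * (x (suc i) ℤ.^ expAt (suc i) es * monomialOff i x es)
monomial-split zero    x []           = refl
monomial-split zero    x (e ∷ [])     = refl
monomial-split zero    x (e ∷ e′ ∷ es) = refl
monomial-split (suc i) x []           = refl
monomial-split (suc i) x (e ∷ es)     =
  trans (cong (x 0 ℤ.^ e *_) (monomial-split i (x ∘ suc) es))
    (front (x 0 ℤ.^ e) (x (suc i) ℤ.^ expAt i es) (x (suc (suc i)) ℤ.^ expAt (suc i) es) (monomialOff i (x ∘ suc) es))

monomial-setPair : ∀ i x a b es →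
  monomial x (setPair i a b es) ≡ x i ℤ.^ a * (x (suc i) ℤ.^ b * monomialOff i x es)
monomial-setPair zero    x a b []            = refl
monomial-setPair zero    x a b (e ∷ [])      = refl
monomial-setPair zero    x a b (e ∷ e′ ∷ es) = refl
monomial-setPair (suc i) x a b []            =
  trans (ℤₚ.*-identityˡ _) (trans (monomial-setPair i (x ∘ suc) a b []) (cong (λ t → x (suc i) ℤ.^ a * (x (suc (suc i)) ℤ.^ b * t)) (off-[] i)))
  where
  off-[] : ∀ i {x} → monomialOff i x [] ≡ 1ℤ
  off-[] zero    = refl
  off-[] (suc i) = refl
monomial-setPair (suc i) x a b (e ∷ es)      =
  trans (cong (x 0 ℤ.^ e *_) (monomial-setPair i (x ∘ suc) a b es))
    (front (x 0 ℤ.^ e) (x (suc i) ℤ.^ a) (x (suc (suc i)) ℤ.^ b) (monomialOff i (x ∘ suc) es))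

monomialOff-swapX : ∀ i x es → monomialOff i (swapX i x) es ≡ monomialOff i x es
monomialOff-swapX zero    x []            = refl
monomialOff-swapX zero    x (e ∷ [])      = refl
monomialOff-swapX zero    x (e ∷ e′ ∷ es) = refl
monomialOff-swapX (suc i) x []            = refl
monomialOff-swapX (suc i) x (e ∷ es)      = cong (x 0 ℤ.^ e *_) (monomialOff-swapX i (x ∘ suc) es)

monomial-raise : ∀ j x es → monomial x (setAt j (suc (expAt j es)) es) ≡ x j * monomial x es
monomial-raise zero    x []       = cong (_* 1ℤ) (ℤₚ.*-identityʳ (x 0))
monomial-raise zero    x (e ∷ es) = ℤₚ.*-assoc (x 0) (x 0 ℤ.^ e) (monomial (x ∘ suc) es)
monomial-raise (suc j) x []       = trans (ℤₚ.*-identityˡ _)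
  (trans (cong (λ t → monomial (x ∘ suc) (setAt j (suc t) [])) (sym (expAt-[] j))) (monomial-raise j (x ∘ suc) []))
  where
  expAt-[] : ∀ j → expAt j [] ≡ 0
  expAt-[] zero    = refl
  expAt-[] (suc j) = refl
monomial-raise (suc j) x (e ∷ es) =
  trans (cong (x 0 ℤ.^ e *_) (monomial-raise j (x ∘ suc) es)) (ring (x 0 ℤ.^ e) (x (suc j)) (monomial (x ∘ suc) es))
  where
  ring : ∀ a b c → a * (b * c) ≡ b * (a * c)
  ring = solve-∀

≮ᵇ⇒≥ : ∀ {m n} → (m <ᵇ n) ≡ false → n ℕ.≤ m
≮ᵇ⇒≥ {m} {n} eq = ℕₚ.≮⇒≥ λ m<n → case trans (sym eq) (Equivalence.to T-≡ (ℕₚ.<⇒<ᵇ m<n)) of λ ()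

module Evaluation (β : ℤ) where
  open DividedDifference β
  open Slide (functions β)

  evalTerm : Term → (ℕ → ℤ) → ℤ
  evalTerm t x = coef t * β ℤ.^ bexp t * monomial x (xexps t)

  eval : Poly → (ℕ → ℤ) → ℤ
  eval []      x = 0ℤ
  eval (t ∷ p) x = evalTerm t x + eval p x

  eval-++ : ∀ p q x → eval (p ++ q) x ≡ eval p x + eval q x
  eval-++ []      q x = sym (ℤₚ.+-identityˡ _)
  eval-++ (t ∷ p) q x = trans (cong (_+_ (evalTerm t x)) (eval-++ p q x)) (sym (ℤₚ.+-assoc (evalTerm t x) (eval p x) (eval q x)))

  eval-mulOneBeta : ∀ i p x → eval (mulOneBeta i p) x ≡ (1ℤ + β * x (suc i)) * eval p x
  eval-mulOneBeta i p x = trans (eval-++ p (map raised p) x) (trans (cong (_+_ (eval p x)) (shifted p)) (ring (eval p x) (β * x (suc i))))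
    where
    ring : ∀ e b → e + b * e ≡ (1ℤ + b) * e
    ring = solve-∀
    ring′ : ∀ c b y β m → c * (β * b) * (y * m) ≡ β * y * (c * b * m)
    ring′ = solve-∀
    raised : Term → Term
    raised t = term (coef t) (suc (bexp t)) (setAt (suc i) (suc (expAt (suc i) (xexps t))) (xexps t))
    shifted : ∀ p → eval (map raised p) x ≡ β * x (suc i) * eval p x
    shifted []      = sym (ℤₚ.*-zeroʳ (β * x (suc i)))
    shifted (t ∷ p) = trans
      (cong₂ _+_ (trans (cong (coef t * (β * β ℤ.^ bexp t) *_) (monomial-raise (suc i) x (xexps t)))
                        (ring′ (coef t) (β ℤ.^ bexp t) (x (suc i)) β (monomial x (xexps t))))
                 (shifted p))
      (sym (ℤₚ.*-distribˡ-+ (β * x (suc i)) (evalTerm t x) (eval p x)))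

  telescope : ∀ x w (h : ℕ → Term) (F : ℕ → ℤ) (f : ℕ → ℕ) d →
    (∀ j → j < d → w * evalTerm (h (f j)) x ≡ F j - F (suc j)) →
    w * eval (map h (applyUpTo f d)) x ≡ F 0 - F d
  telescope x w h F f zero    hyp = trans (ℤₚ.*-zeroʳ w) (sym (ℤₚ.+-inverseʳ (F 0)))
  telescope x w h F f (suc d) hyp =
    trans (ℤₚ.*-distribˡ-+ w (evalTerm (h (f 0)) x) (eval (map h (applyUpTo (f ∘ suc) d)) x))
    (trans (cong₂ _+_ (hyp 0 (ℕ.s≤s ℕ.z≤n)) (telescope x w h (F ∘ suc) (f ∘ suc) d (λ j j<d → hyp (suc j) (ℕ.s≤s j<d))))
      (ring (F 0) (F 1) (F (suc d))))
    where
    ring : ∀ a b c → (a - b) + (b - c) ≡ a - c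
    ring = solve-∀

  geometric : ∀ i x c e es a b → b ℕ.≤ a →
    (x i - x (suc i)) * eval (map (λ k → term c e (setPair i (a ∸ 1 ∸ k) (b ℕ.+ k) es)) (upTo (a ∸ b))) x
      ≡ c * β ℤ.^ e * (x i ℤ.^ a * (x (suc i) ℤ.^ b * monomialOff i x es))
        - c * β ℤ.^ e * (x i ℤ.^ b * (x (suc i) ℤ.^ a * monomialOff i x es))
  geometric i x c e es a b b≤a =
    trans (telescope x (x i - x (suc i)) (λ k → term c e (setPair i (a ∸ 1 ∸ k) (b ℕ.+ k) es)) F (λ k → k) (a ∸ b) hyp)
      (cong₂ _-_ (cong (λ t → c * β ℤ.^ e * (x i ℤ.^ a * (x (suc i) ℤ.^ t * monomialOff i x es))) (ℕₚ.+-identityʳ b))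
                 (cong₂ (λ s t → c * β ℤ.^ e * (x i ℤ.^ s * (x (suc i) ℤ.^ t * monomialOff i x es)))
                        (ℕₚ.m∸[m∸n]≡n b≤a) (ℕₚ.m+[n∸m]≡n b≤a)))
    where
    -- The k-th summand of the quotient times x - y is `F k - F (suc k)`; at k = a - b the two
    -- exponents have traded places.
    F : ℕ → ℤ
    F k = c * β ℤ.^ e * (x i ℤ.^ (a ∸ k) * (x (suc i) ℤ.^ (b ℕ.+ k) * monomialOff i x es))
    ring : ∀ x y C X Y r → (x - y) * (C * (X * (Y * r))) ≡ C * (x * X * (Y * r)) - C * (X * (y * Y * r))
    ring = solve-∀
    exponent : ∀ j → j < a ∸ b → a ∸ j ≡ suc (a ∸ 1 ∸ j)
    exponent j j< = trans (sym (ℕₚ.suc-pred (a ∸ j) ⦃ ℕ.>-nonZero (ℕₚ.m<n⇒0<n∸m (ℕₚ.<-≤-trans j< (ℕₚ.m∸n≤m a b))) ⦄))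
      (cong suc (trans (ℕₚ.pred[m∸n]≡m∸[1+n] a j) (sym (ℕₚ.∸-+-assoc a 1 j))))
    hyp : ∀ j → j < a ∸ b → (x i - x (suc i)) * evalTerm (term c e (setPair i (a ∸ 1 ∸ j) (b ℕ.+ j) es)) x ≡ F j - F (suc j)
    hyp j j< rewrite monomial-setPair i x (a ∸ 1 ∸ j) (b ℕ.+ j) es | exponent j j< | ℕₚ.+-suc b j | sym (ℕₚ.∸-+-assoc a 1 j) =
      ring (x i) (x (suc i)) (c * β ℤ.^ e) (x i ℤ.^ (a ∸ 1 ∸ j)) (x (suc i) ℤ.^ (b ℕ.+ j)) (monomialOff i x es)

  eval-ddTerm : ∀ i t x → (x i - x (suc i)) * eval (ddTerm i t) x ≡ evalTerm t x - evalTerm t (swapX i x)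
  eval-ddTerm i (term c e es) x
    rewrite monomial-split i x es | monomial-split i (swapX i x) es
          | monomialOff-swapX i x es | swapX-i i x | swapX-1+i i x
    with expAt i es | expAt (suc i) es
  ... | a | b with b <ᵇ a in b<a | a <ᵇ b in a<b
  ...   | true  | _     = trans (geometric i x c e es a b (ℕₚ.<⇒≤ (ℕₚ.<ᵇ⇒< b a (Equivalence.from T-≡ b<a))))
    (ring (c * β ℤ.^ e) (x i ℤ.^ a) (x (suc i) ℤ.^ b) (x i ℤ.^ b) (x (suc i) ℤ.^ a) (monomialOff i x es))
    where
    ring : ∀ C xa yb xb ya r → C * (xa * (yb * r)) - C * (xb * (ya * r)) ≡ C * (xa * (yb * r)) - C * (ya * (xb * r))
    ring = solve-∀
  ...   | false | true  = trans (geometric i x (- c) e es b a (ℕₚ.<⇒≤ (ℕₚ.<ᵇ⇒< a b (Equivalence.from T-≡ a<b))))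
    (ring c (β ℤ.^ e) (x i ℤ.^ a) (x (suc i) ℤ.^ b) (x i ℤ.^ b) (x (suc i) ℤ.^ a) (monomialOff i x es))
    where
    ring : ∀ c B xa yb xb ya r → (- c) * B * (xb * (ya * r)) - (- c) * B * (xa * (yb * r)) ≡ c * B * (xa * (yb * r)) - c * B * (ya * (xb * r))
    ring = solve-∀
  ...   | false | false with ℕₚ.≤-antisym {a} {b} (≮ᵇ⇒≥ b<a) (≮ᵇ⇒≥ a<b)
  ...     | refl = ring (x i - x (suc i)) (c * β ℤ.^ e) (x i ℤ.^ a) (x (suc i) ℤ.^ a) (monomialOff i x es)
    where
    ring : ∀ w C xa ya r → w * 0ℤ ≡ C * (xa * (ya * r)) - C * (ya * (xa * r))
    ring = solve-∀

  eval-dd : ∀ i p x → (x i - x (suc i)) * eval (dd i p) x ≡ eval p x - eval p (swapX i x)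
  eval-dd i []      x = ℤₚ.*-zeroʳ (x i - x (suc i))
  eval-dd i (t ∷ p) x = trans (cong ((x i - x (suc i)) *_) (eval-++ (ddTerm i t) (dd i p) x))
    (trans (ℤₚ.*-distribˡ-+ (x i - x (suc i)) (eval (ddTerm i t) x) (eval (dd i p) x))
    (trans (cong₂ _+_ (eval-ddTerm i t x) (eval-dd i p x))
      (ring (evalTerm t x) (evalTerm t (swapX i x)) (eval p x) (eval p (swapX i x)))))
    where
    ring : ∀ a b c d → (a - b) + (c - d) ≡ (a + c) - (b + d)
    ring = solve-∀

  eval-piOp : ∀ i p → Cleared i (eval (piOp i p)) (eval p)
  eval-piOp i p x = trans (eval-dd i (mulOneBeta i p) x)
    (cong₂ _-_ (eval-mulOneBeta i p x)
      (trans (eval-mulOneBeta i p (swapX i x)) (cong (λ t → (1ℤ + β * t) * eval p (swapX i x)) (swapX-1+i i x))))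

-- Cancelling the difference of two coordinates

-- The trace of polynomiality that suffices: such a function is determined by its values off the
-- hyperplane `x i ≡ x (suc i)`.
Congruent : ((ℕ → ℤ) → ℤ) → Set
Congruent f = ∀ m x y → (∀ j → m ∣ x j - y j) → m ∣ f x - f y

congruent-const : ∀ c → Congruent (λ _ → c)
congruent-const c m x y _ = divides 0ℤ (ℤₚ.+-inverseʳ c)

congruent-+ : ∀ {f g} → Congruent f → Congruent g → Congruent (λ x → f x + g x)
congruent-+ {f} {g} cf cg m x y h =
  subst (m ∣_) (ring (f x) (f y) (g x) (g y)) (∣.∣m∣n⇒∣m+n (cf m x y h) (cg m x y h))
  where
  ring : ∀ a b c d → (a - b) + (c - d) ≡ (a + c) - (b + d)
  ring = solve-∀

congruent-* : ∀ {f g} → Congruent f → Congruent g → Congruent (λ x → f x * g x)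
congruent-* {f} {g} cf cg m x y h =
  subst (m ∣_) (ring (f x) (f y) (g x) (g y))
    (∣.∣m∣n⇒∣m+n (∣.∣n⇒∣m*n (f x) (cg m x y h)) (∣.∣n⇒∣m*n (g y) (cf m x y h)))
  where
  ring : ∀ a b c d → a * (c - d) + d * (a - b) ≡ a * c - b * d
  ring = solve-∀

congruent-^ : ∀ {f} → Congruent f → ∀ n → Congruent (λ x → f x ℤ.^ n)
congruent-^ cf zero    = congruent-const 1ℤ
congruent-^ {f} cf (suc n) = congruent-* {f} {λ x → f x ℤ.^ n} cf (congruent-^ cf n)

congruent-monomial : ∀ es → Congruent (λ x → monomial x es)
congruent-monomial []       = congruent-const 1ℤ
congruent-monomial (e ∷ es) =
  congruent-* {λ x → x 0 ℤ.^ e} {λ x → monomial (x ∘ suc) es} (congruent-^ {λ x → x 0} (λ m x y h → h 0) e)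
    (λ m x y h → congruent-monomial es m (x ∘ suc) (y ∘ suc) (h ∘ suc))

∣<⇒≡0 : ∀ z → + suc ℤ.∣ z ∣ ∣ z → z ≡ 0ℤ
∣<⇒≡0 z d with ℤ.∣ z ∣ in eq | ∣⇒∣ᵤ d
... | zero  | _  = ℤₚ.∣i∣≡0⇒i≡0 eq
... | suc n | d′ = ⊥-elim (ℕₚ.<-irrefl refl (ℕ∣.∣⇒≤ d′))

-- Where x i = x (suc i), moving x i by any m ≠ 0 allows the cancellation, and changes f and g by multiples of m.
cancel-difference : ∀ {f g} i → Congruent f → Congruent g →
  (∀ x → (x i - x (suc i)) * f x ≡ (x i - x (suc i)) * g x) → ∀ x → f x ≡ g x
cancel-difference {f} {g} i cf cg hyp x with x i ℤₚ.≟ x (suc i)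
... | no  xᵢ≢ = off-diagonal xᵢ≢
  where
  off-diagonal : x i ≢ x (suc i) → f x ≡ g x
  off-diagonal xᵢ≢ = ℤₚ.*-cancelˡ-≡ (x i - x (suc i)) (f x) (g x)
    ⦃ ℤ.≢-nonZero (xᵢ≢ ∘ ℤₚ.i-j≡0⇒i≡j (x i) (x (suc i))) ⦄ (hyp x)
... | yes xᵢ≡ = ℤₚ.i-j≡0⇒i≡j (f x) (g x) (∣<⇒≡0 (f x - g x) m∣)
  where
  m : ℤ
  m = + suc ℤ.∣ f x - g x ∣
  y : ℕ → ℤ
  y j = if does (j ≟ i) then x j + m else x j
  y-i : y i ≡ x i + m
  y-i rewrite dec-true (i ≟ i) refl = refl
  y-1+i : y (suc i) ≡ x (suc i)
  y-1+i rewrite dec-false (suc i ≟ i) ℕₚ.1+n≢n = refl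
  ring : ∀ a m → m + a ≡ a + m
  ring = solve-∀
  y≢ : y i - y (suc i) ≡ m
  y≢ rewrite y-i | y-1+i | xᵢ≡ = ring′ (x (suc i)) m
    where
    ring′ : ∀ a m → (a + m) - a ≡ m
    ring′ = solve-∀
  fy≡gy : f y ≡ g y
  fy≡gy = ℤₚ.*-cancelˡ-≡ m (f y) (g y) (subst (λ t → t * f y ≡ t * g y) y≢ (hyp y))
  close : ∀ j → m ∣ x j - y j
  close j with j ≟ i
  ... | yes refl rewrite dec-true (j ≟ j) refl = divides -1ℤ (ring″ (x j) m)
    where
    ring″ : ∀ a m → a - (a + m) ≡ -1ℤ * m
    ring″ = solve-∀
  ... | no j≢i rewrite dec-false (j ≟ i) j≢i = divides 0ℤ (ℤₚ.+-inverseʳ (x j))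
  ring‴ : ∀ a b c → (a - b) - (c - b) ≡ a - c
  ring‴ = solve-∀
  m∣ : m ∣ f x - g x
  m∣ = subst (m ∣_) (trans (cong (λ t → (f x - f y) - (g x - t)) (sym fy≡gy)) (ring‴ (f x) (f y) (g x)))
         (∣.∣m∣n⇒∣m-n (cf m x y close) (cg m x y close))

-- The recursion computes the Grothendieck polynomial

-- The exact number of ascent swaps from a word with distinct letters to its decreasing
-- rearrangement, to be compared with the fuel of `groth`.
noninversions : Word → ℕ
noninversions []      = 0
noninversions (x ∷ w) = length (filter (x <?_) w) ℕ.+ noninversions w

noninversions≤ : ∀ w → noninversions w ≤ length w ℕ.* length w
noninversions≤ []      = ℕ.z≤n
noninversions≤ (x ∷ w) = ℕₚ.≤-trans (ℕₚ.+-mono-≤ (Listₚ.length-filter (x <?_) w) (noninversions≤ w))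
  (ℕₚ.+-mono-≤ (ℕₚ.n≤1+n (length w)) (ℕₚ.*-monoʳ-≤ (length w) (ℕₚ.n≤1+n (length w))))

noninversions-swap : ∀ A {p q} B → p < q →
  noninversions (A ++ p ∷ q ∷ B) ≡ suc (noninversions (A ++ q ∷ p ∷ B))
noninversions-swap [] {p} {q} B p<q
  rewrite Listₚ.filter-accept (p <?_) {q} {B} p<q
        | Listₚ.filter-reject (q <?_) {p} {B} (ℕₚ.<⇒≯ p<q)
  = cong suc (x+[y+z] (length (filter (p <?_) B)) (length (filter (q <?_) B)) (noninversions B))
  where
  x+[y+z] : ∀ x y z → x ℕ.+ (y ℕ.+ z) ≡ y ℕ.+ (x ℕ.+ z)
  x+[y+z] x y z = trans (sym (ℕₚ.+-assoc x y z)) (trans (cong (ℕ._+ z) (ℕₚ.+-comm x y)) (ℕₚ.+-assoc y x z))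
noninversions-swap (a ∷ A) {p} {q} B p<q =
  trans (cong₂ ℕ._+_ (↭-length (filter-↭ (a <?_) (++⁺ˡ A (swap p q ↭-refl)))) (noninversions-swap A B p<q))
        (ℕₚ.+-suc (length (filter (a <?_) (A ++ q ∷ p ∷ B))) _)

firstAscent-just : ∀ w {i} → firstAscent w ≡ just i →
  ∃[ A ] ∃[ p ] ∃[ q ] ∃[ B ]
    (w ≡ A ++ p ∷ q ∷ B × length A ≡ i × p < q × swapAt i w ≡ A ++ q ∷ p ∷ B)
firstAscent-just (x ∷ y ∷ w) eq with x <ᵇ y in x<y
firstAscent-just (x ∷ y ∷ w) refl | true =
  [] , x , y , w , refl , refl , ℕₚ.<ᵇ⇒< x y (Equivalence.from T-≡ x<y) , refl
firstAscent-just (x ∷ y ∷ w) eq | false with firstAscent (y ∷ w) in eq′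
firstAscent-just (x ∷ y ∷ w) refl | false | just i
  with A , p , q , B , w≡ , refl , p<q , swap≡ ← firstAscent-just (y ∷ w) eq′ =
  x ∷ A , p , q , B , cong (x ∷_) w≡ , refl , p<q , cong (x ∷_) swap≡

firstAscent-nothing : ∀ w → firstAscent w ≡ nothing → Unique w → Linked ℕ._>_ w
firstAscent-nothing []          eq u = []
firstAscent-nothing (x ∷ [])    eq u = [-]
firstAscent-nothing (x ∷ y ∷ w) eq ((x≢y ∷ _) ∷ u) with x <ᵇ y in x<y
... | false with firstAscent (y ∷ w) in eq′
...   | nothing = ℕₚ.≤∧≢⇒< (≮ᵇ⇒≥ x<y) (x≢y ∘ sym) ∷ firstAscent-nothing (y ∷ w) eq′ u

reverse-decreasing : ∀ {w} → AllPairs ℕ._>_ w → AllPairs _<_ (reverse w)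
reverse-decreasing {[]}    []       = []
reverse-decreasing {x ∷ w} (x> ∷ d) rewrite Listₚ.unfold-reverse x w =
  AllPairsₚ.++⁺ (reverse-decreasing d) ([] ∷ []) (All.map (_∷ []) (All-resp-↭ (↭-sym (↭-reverse w)) x>))

reverse-around : ∀ (A : Word) p q B → reverse (A ++ p ∷ q ∷ B) ≡ reverse B ++ q ∷ p ∷ reverse A
reverse-around A p q B
  rewrite Listₚ.reverse-++ A (p ∷ q ∷ B) | Listₚ.unfold-reverse p (q ∷ B) | Listₚ.unfold-reverse q B
        | Listₚ.++-assoc (reverse B ++ q ∷ []) (p ∷ []) (reverse A)
        | Listₚ.++-assoc (reverse B) (q ∷ []) (p ∷ reverse A) = refl

prefixProduct : ℕ → (ℕ → ℤ) → ℤ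
prefixProduct zero    x = 1ℤ
prefixProduct (suc n) x = x n * prefixProduct n x

prefixProduct-shift : ∀ n x → prefixProduct (suc n) x ≡ x 0 * prefixProduct n (x ∘ suc)
prefixProduct-shift zero    x = refl
prefixProduct-shift (suc n) x = trans (cong (x (suc n) *_) (prefixProduct-shift n x)) (ring (x (suc n)) (x 0) (prefixProduct n (x ∘ suc)))
  where
  ring : ∀ a b c → a * (b * c) ≡ b * (a * c)
  ring = solve-∀

monomial-downFrom : ∀ n x → monomial x (downFrom (suc n)) ≡ prefixProduct n x * monomial x (downFrom n)
monomial-downFrom zero    x = refl
monomial-downFrom (suc n) x = trans (cong (x 0 ℤ.^ suc n *_) (monomial-downFrom n (x ∘ suc)))
  (trans (ring (x 0) (x 0 ℤ.^ n) (prefixProduct n (x ∘ suc)) (monomial (x ∘ suc) (downFrom n)))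
    (cong (_* (x 0 ℤ.^ n * monomial (x ∘ suc) (downFrom n))) (sym (prefixProduct-shift n x))))
  where
  ring : ∀ a b c d → (a * b) * (c * d) ≡ (a * c) * (b * d)
  ring = solve-∀

module Groth (β : ℤ) where
  open Scalars (functions β)
  open Slide (functions β)
  open DividedDifference β
  open Evaluation β
  open Related.Compatible

  congruent-evalTerm : ∀ t → Congruent (evalTerm t)
  congruent-evalTerm t = congruent-* {λ _ → coef t * β ℤ.^ bexp t} {λ x → monomial x (xexps t)}
    (congruent-const (coef t * β ℤ.^ bexp t)) (congruent-monomial (xexps t))

  congruent-eval : ∀ p → Congruent (eval p)
  congruent-eval []      = congruent-const 0ℤ
  congruent-eval (t ∷ p) = congruent-+ {evalTerm t} {eval p} (congruent-evalTerm t) (congruent-eval p)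

  congruent-compatible : ∀ i → Related.Compatible (functions β) (functions β) (λ f _ → Congruent f) i
  congruent-compatible i .⊕-rel {f} {_} {g} cf cg = congruent-+ {f} {g} cf cg
  congruent-compatible i .𝟘-rel = congruent-const 0ℤ
  congruent-compatible i .X-rel {j} {f} _ cf = congruent-* {λ x → x j} {f} (λ m x y h → h j) cf
  congruent-compatible i .Y-rel {j} {f} _ cf = congruent-* {λ x → 1ℤ + β * x j} {f}
    (congruent-+ {λ _ → 1ℤ} {λ x → β * x j} (congruent-const 1ℤ)
      (congruent-* {λ _ → β} {λ x → x j} (congruent-const β) (λ m x y h → h j))) cf

  congruent-value : ∀ n k z → Congruent (value n k z)
  congruent-value n k z = Related.value-rel _ _ _ (congruent-compatible (length z)) (congruent-const 1ℤ) n k z (ℕₚ.n≤1+n _)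

  Vanishes : V → V → Set
  Vanishes f _ = ∀ x → f x ≡ 0ℤ

  vanishes-compatible : ∀ i → Related.Compatible (functions β) (functions β) Vanishes i
  vanishes-compatible i .⊕-rel p q x = cong₂ _+_ (p x) (q x)
  vanishes-compatible i .𝟘-rel x = refl
  vanishes-compatible i .X-rel {j} _ p x = trans (cong (x j *_) (p x)) (ℤₚ.*-zeroʳ (x j))
  vanishes-compatible i .Y-rel {j} _ p x = trans (cong ((1ℤ + β * x j) *_) (p x)) (ℤₚ.*-zeroʳ (1ℤ + β * x j))

  -- The hypothesis of `slide-rel` concerns rearrangements of `h ∷ z` that contain `k`. There are
  -- none, so every scan ends in the default `𝟘`.
  slide-absent : ∀ k K h z → k ∉ h ∷ z → Vanishes (slide k K h z) 𝟘
  slide-absent k K h z k∉ = Related.slide-rel _ _ Vanishes (vanishes-compatible (length z)) k K K h z ℕₚ.≤-refl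
    (λ z′ ρ → ⊥-elim (k∉ (∈-resp-↭ ρ (here refl))))

  -- Once released, `k` cannot be held at the end; only the scan that passes every letter
  -- contributes.
  slide-min : ∀ k K z → All (k <_) z → ∀ x → slide k K k z x ≡ prefixProduct (length z) x * K z x
  slide-min k K []      _ x rewrite dec-true (k ≟ k) refl = sym (ℤₚ.*-identityˡ (K [] x))
  slide-min k K (o ∷ z) (k<o ∷ k<z) x rewrite slide-≮ k K z (ℕₚ.<⇒≯ k<o) =
    trans (cong₂ (λ s t → x (length z) * s + (1ℤ + β * x (length z)) * t)
             (slide-min k (K ∘ (o ∷_)) z k<z x)
             (slide-absent k (K ∘ (k ∷_)) o z (λ k∈ → ℕₚ.<-irrefl refl (All.lookup (k<o ∷ k<z) k∈)) x))
      (ring (x (length z)) (prefixProduct (length z) x) (K (o ∷ z) x) (1ℤ + β * x (length z)))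
    where
    ring : ∀ a p v y → a * (p * v) + y * 0ℤ ≡ a * p * v
    ring = solve-∀

  value-increasing : ∀ n k z → AllPairs _<_ z → All (Within k n) z →
    ∀ x → value n k z x ≡ monomial x (downFrom (length z))
  value-increasing zero    k []      _ _ x = refl
  value-increasing zero    k (y ∷ z) _ ((k≤y , y<k+0) ∷ _) x =
    ⊥-elim (ℕₚ.<⇒≱ (subst (y <_) (ℕₚ.+-identityʳ k) y<k+0) k≤y)
  value-increasing (suc n) k z inc w x with k ∈? z
  ... | no  k∉z = value-increasing n (suc k) z inc (within-∉ k∉z w) x
  value-increasing (suc n) k (y ∷ z) (y< ∷ inc) ((k≤y , _) ∷ w) x | yes (there k∈z) =
    ⊥-elim (ℕₚ.<⇒≱ (All.lookup y< k∈z) k≤y)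
  value-increasing (suc n) k (y ∷ z) (y< ∷ inc) (_ ∷ w) x | yes (here refl) =
    trans (slide-min k _ z y< x)
    (trans (cong (prefixProduct (length z) x *_)
             (value-increasing n (suc k) z inc (within-∉ (λ k∈z → ℕₚ.<-irrefl refl (All.lookup y< k∈z)) w) x))
      (sym (monomial-downFrom (length z) x)))

  eval-topPoly : ∀ n x → eval (topPoly n) x ≡ monomial x (downFrom n)
  eval-topPoly n x = trans (ℤₚ.+-identityʳ _) (ℤₚ.*-identityˡ (monomial x (downFrom n)))

  descending-value : ∀ N k w → Linked ℕ._>_ w → All (Within k N) w →
    ∀ x → eval (topPoly (length w)) x ≡ value N k (reverse w) x
  descending-value N k w d ws x = sym (trans
    (value-increasing N k (reverse w) (reverse-decreasing (Linked⇒AllPairs (λ a>b b>c → ℕₚ.<-trans b>c a>b) d))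
      (All-resp-↭ (↭-sym (↭-reverse w)) ws) x)
    (trans (cong (λ n → monomial x (downFrom n)) (Listₚ.length-reverse w)) (sym (eval-topPoly (length w) x))))

  -- The range of the letters, given by `k` and `N`, is independent of the length `n`. Words with
  -- gaps are thus treated as they stand, and all subwords of one permutation can share a range.
  eval-grothFuel : ∀ N k f n w → length w ≡ n → Unique w → All (Within k N) w → noninversions w ≤ f →
    ∀ x → eval (grothFuel n f w) x ≡ value N k (reverse w) x
  eval-grothFuel N k zero n w refl u ws le x with firstAscent w in eq
  ... | nothing = descending-value N k w (firstAscent-nothing w eq u) ws x
  ... | just i with A , p , q , B , refl , refl , p<q , _ ← firstAscent-just w eq =
    case subst (_≤ 0) (noninversions-swap A B p<q) le of λ ()
  eval-grothFuel N k (suc f) n w refl u ws le with firstAscent w in eq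
  ... | nothing = descending-value N k w (firstAscent-nothing w eq u) ws
  ... | just i with A , p , q , B , refl , refl , p<q , swap≡ ← firstAscent-just w eq
    rewrite swap≡ | reverse-around A p q B =
    -- Both sides satisfy the cleared equation with the same lower function, by the induction
    -- hypothesis `lower`.
    cancel-difference (length A) (congruent-eval (piOp (length A) g)) (congruent-value N k (reverse B ++ q ∷ p ∷ reverse A)) λ x →
      trans (eval-piOp (length A) g x)
      (trans (cong₂ (λ s t → (1ℤ + β * x (suc (length A))) * s - (1ℤ + β * x (length A)) * t)
               (lower x) (lower (swapX (length A) x)))
        (sym (Pi.step piv x)))
    where
    ρ : (A ++ p ∷ q ∷ B) ↭ (A ++ q ∷ p ∷ B)
    ρ = ++⁺ˡ A (swap p q ↭-refl)
    σ : (A ++ p ∷ q ∷ B) ↭ (reverse B ++ q ∷ p ∷ reverse A)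
    σ = ↭-trans (↭-sym (↭-reverse (A ++ p ∷ q ∷ B))) (↭-reflexive (reverse-around A p q B))
    g : Poly
    g = grothFuel (length (A ++ p ∷ q ∷ B)) f (A ++ q ∷ p ∷ B)
    lower : ∀ x → eval g x ≡ value N k (reverse B ++ p ∷ q ∷ reverse A) x
    lower x = trans
      (eval-grothFuel N k f _ (A ++ q ∷ p ∷ B) (sym (↭-length ρ)) (unique-resp-↭ ρ u) (All-resp-↭ ρ ws)
        (ℕₚ.≤-pred (subst (_≤ suc f) (noninversions-swap A B p<q) le)) x)
      (cong (λ z → value N k z x) (reverse-around A q p B))
    piv : Pi (length A) (value N k (reverse B ++ q ∷ p ∷ reverse A)) (value N k (reverse B ++ p ∷ q ∷ reverse A))
    piv = subst (λ j → Pi j (value N k (reverse B ++ q ∷ p ∷ reverse A)) (value N k (reverse B ++ p ∷ q ∷ reverse A))) (Listₚ.length-reverse A)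
      (value-pi N k (reverse B) (reverse A) p<q (unique-resp-↭ σ u) (All-resp-↭ σ ws))

  eval-groth : ∀ N k w → Unique w → All (Within k N) w → ∀ x → eval (groth w) x ≡ value N k (reverse w) x
  eval-groth N k w u ws = eval-grothFuel N k _ _ w refl u ws (noninversions≤ w)

-- β-polynomials are determined by their integer values

evalB : ℤ → BPoly → ℤ
evalB β []            = 0ℤ
evalB β ((c , e) ∷ p) = c * β ℤ.^ e + evalB β p

evalB-++ : ∀ β p q → evalB β (p ++ q) ≡ evalB β p + evalB β q
evalB-++ β []            q = sym (ℤₚ.+-identityˡ (evalB β q))
evalB-++ β ((c , e) ∷ p) q = trans (cong (_+_ (c * β ℤ.^ e)) (evalB-++ β p q)) (sym (ℤₚ.+-assoc (c * β ℤ.^ e) (evalB β p) (evalB β q)))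

evalB-scaleB : ∀ β c p → evalB β (scaleB c p) ≡ c * evalB β p
evalB-scaleB β c []            = sym (ℤₚ.*-zeroʳ c)
evalB-scaleB β c ((d , e) ∷ p) = trans (cong (_+_ (c * d * β ℤ.^ e)) (evalB-scaleB β c p)) (ring c d (β ℤ.^ e) (evalB β p))
  where
  ring : ∀ c d b p → c * d * b + c * p ≡ c * (d * b + p)
  ring = solve-∀

eval-evalOnes : ∀ β p → evalB β (evalOnes p) ≡ Evaluation.eval β p (λ _ → 1ℤ)
eval-evalOnes β []      = refl
eval-evalOnes β (t ∷ p) = cong₂ _+_
  (trans (sym (ℤₚ.*-identityʳ (coef t * β ℤ.^ bexp t))) (cong (coef t * β ℤ.^ bexp t *_) (sym (ones (xexps t)))))
  (eval-evalOnes β p)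
  where
  ones : ∀ es → monomial (λ _ → 1ℤ) es ≡ 1ℤ
  ones []       = refl
  ones (e ∷ es) = cong₂ _*_ (ℤₚ.^-zeroˡ e) (ones es)

pick : ℕ → ℤ × ℕ → ℤ
pick k (c , e) = if e ℕ.≡ᵇ k then c else 0ℤ

coeffB-∷ : ∀ k t p → coeffB k (t ∷ p) ≡ pick k t + coeffB k p
coeffB-∷ k (c , e) p with e ℕ.≡ᵇ k
... | true  = refl
... | false = sym (ℤₚ.+-identityˡ (coeffB k p))

coeffB-++ : ∀ k p q → coeffB k (p ++ q) ≡ coeffB k p + coeffB k q
coeffB-++ k []      q = sym (ℤₚ.+-identityˡ (coeffB k q))
coeffB-++ k (t ∷ p) q = trans (coeffB-∷ k t (p ++ q)) (trans (cong (_+_ (pick k t)) (coeffB-++ k p q))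
  (trans (sym (ℤₚ.+-assoc (pick k t) (coeffB k p) (coeffB k q))) (cong (_+ coeffB k q) (sym (coeffB-∷ k t p)))))

coeffB-scaleB : ∀ k c p → coeffB k (scaleB c p) ≡ c * coeffB k p
coeffB-scaleB k c []            = sym (ℤₚ.*-zeroʳ c)
coeffB-scaleB k c ((d , e) ∷ p) = trans (coeffB-∷ k (c * d , e) (scaleB c p))
  (trans (cong₂ _+_ picked (coeffB-scaleB k c p))
  (trans (sym (ℤₚ.*-distribˡ-+ c (pick k (d , e)) (coeffB k p))) (cong (c *_) (sym (coeffB-∷ k (d , e) p)))))
  where
  picked : pick k (c * d , e) ≡ c * pick k (d , e)
  picked with e ℕ.≡ᵇ k
  ... | true  = refl
  ... | false = sym (ℤₚ.*-zeroʳ c)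

addAt : ℤ → ℕ → List ℤ → List ℤ
addAt c zero    []       = c ∷ []
addAt c zero    (d ∷ ds) = c + d ∷ ds
addAt c (suc e) []       = 0ℤ ∷ addAt c e []
addAt c (suc e) (d ∷ ds) = d ∷ addAt c e ds

dense : BPoly → List ℤ
dense []            = []
dense ((c , e) ∷ p) = addAt c e (dense p)

nth : ℕ → List ℤ → ℤ
nth k       []       = 0ℤ
nth zero    (c ∷ cs) = c
nth (suc k) (c ∷ cs) = nth k cs

horner : List ℤ → ℤ → ℤ
horner []       β = 0ℤ
horner (c ∷ cs) β = c + β * horner cs β

nth-addAt : ∀ k c e cs → nth k (addAt c e cs) ≡ pick k (c , e) + nth k cs
nth-addAt zero    c zero    []       = sym (ℤₚ.+-identityʳ c)
nth-addAt zero    c zero    (d ∷ ds) = refl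
nth-addAt zero    c (suc e) []       = refl
nth-addAt zero    c (suc e) (d ∷ ds) = sym (ℤₚ.+-identityˡ d)
nth-addAt (suc k) c zero    []       = refl
nth-addAt (suc k) c zero    (d ∷ ds) = sym (ℤₚ.+-identityˡ (nth k ds))
nth-addAt (suc k) c (suc e) []       = nth-addAt k c e []
nth-addAt (suc k) c (suc e) (d ∷ ds) = nth-addAt k c e ds

horner-addAt : ∀ β c e cs → horner (addAt c e cs) β ≡ c * β ℤ.^ e + horner cs β
horner-addAt β c zero    []       = ring c β
  where
  ring : ∀ c β → c + β * 0ℤ ≡ c * 1ℤ + 0ℤ
  ring = solve-∀
horner-addAt β c zero    (d ∷ ds) = ring c d (β * horner ds β)
  where
  ring : ∀ c d h → c + d + h ≡ c * 1ℤ + (d + h)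
  ring = solve-∀
horner-addAt β c (suc e) []       = trans (cong (λ t → 0ℤ + β * t) (horner-addAt β c e [])) (ring β c (β ℤ.^ e))
  where
  ring : ∀ β c b → 0ℤ + β * (c * b + 0ℤ) ≡ c * (β * b) + 0ℤ
  ring = solve-∀
horner-addAt β c (suc e) (d ∷ ds) = trans (cong (λ t → d + β * t) (horner-addAt β c e ds)) (ring β c (β ℤ.^ e) d (horner ds β))
  where
  ring : ∀ β c b d h → d + β * (c * b + h) ≡ c * (β * b) + (d + β * h)
  ring = solve-∀

nth-dense : ∀ k p → nth k (dense p) ≡ coeffB k p
nth-dense k []            = refl
nth-dense k ((c , e) ∷ p) = trans (nth-addAt k c e (dense p)) (trans (cong (_+_ (pick k (c , e))) (nth-dense k p)) (sym (coeffB-∷ k (c , e) p)))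

horner-dense : ∀ β p → horner (dense p) β ≡ evalB β p
horner-dense β []            = refl
horner-dense β ((c , e) ∷ p) = trans (horner-addAt β c e (dense p)) (cong (_+_ (c * β ℤ.^ e)) (horner-dense β p))

horner-congruent : ∀ cs m x y → m ∣ x - y → m ∣ horner cs x - horner cs y
horner-congruent []       m x y _ = divides 0ℤ refl
horner-congruent (c ∷ cs) m x y h = subst (m ∣_) (ring c x y (horner cs x) (horner cs y))
  (∣.∣m∣n⇒∣m+n (∣.∣n⇒∣m*n x (horner-congruent cs m x y h)) (∣.∣n⇒∣m*n (horner cs y) h))
  where
  ring : ∀ c x y p q → x * (p - q) + q * (x - y) ≡ (c + x * p) - (c + y * q)
  ring = solve-∀

-- Dividing by β loses the value at 0. That value is congruent modulo `m` to the value at `m`, which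
-- is 0, and `m` exceeds its absolute value.
horner-zero : ∀ cs → (∀ β → horner cs β ≡ 0ℤ) → ∀ k → nth k cs ≡ 0ℤ
horner-zero []       hyp k       = refl
horner-zero (c ∷ cs) hyp zero    = trans (sym (ℤₚ.+-identityʳ c)) (hyp 0ℤ)
horner-zero (c ∷ cs) hyp (suc k) = horner-zero cs quotient k
  where
  c≡0 : c ≡ 0ℤ
  c≡0 = horner-zero (c ∷ cs) hyp zero
  nonzero : ∀ β → .⦃ ℤ.NonZero β ⦄ → horner cs β ≡ 0ℤ
  nonzero β = ℤₚ.*-cancelˡ-≡ β (horner cs β) 0ℤ
    (trans (sym (ℤₚ.+-identityˡ (β * horner cs β)))
    (trans (cong (_+ β * horner cs β) (sym c≡0)) (trans (hyp β) (sym (ℤₚ.*-zeroʳ β)))))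
  m : ℤ
  m = + suc ℤ.∣ horner cs 0ℤ ∣
  at-zero : m ∣ horner cs 0ℤ
  at-zero = subst (m ∣_) (trans (cong (λ t → horner cs 0ℤ - t) (nonzero m)) (ℤₚ.+-identityʳ (horner cs 0ℤ)))
    (horner-congruent cs m 0ℤ m (divides -1ℤ (ring m)))
    where
    ring : ∀ m → 0ℤ - m ≡ -1ℤ * m
    ring = solve-∀
  quotient : ∀ β → horner cs β ≡ 0ℤ
  quotient (+ zero)    = ∣<⇒≡0 (horner cs 0ℤ) at-zero
  quotient (+ suc n)   = nonzero (+ suc n)
  quotient ℤ.-[1+ n ]  = nonzero ℤ.-[1+ n ]

coeffB-unique : ∀ p q → (∀ β → evalB β p ≡ evalB β q) → ∀ k → coeffB k p ≡ coeffB k q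
coeffB-unique p q hyp k = ℤₚ.i-j≡0⇒i≡j (coeffB k p) (coeffB k q)
  (trans (sym (difference {a = coeffB k p} {coeffB k q} (coeffB-++ k p (scaleB -1ℤ q)) (coeffB-scaleB k -1ℤ q)))
  (trans (sym (nth-dense k (p ++ scaleB -1ℤ q)))
    (horner-zero (dense (p ++ scaleB -1ℤ q)) (λ β →
      trans (horner-dense β (p ++ scaleB -1ℤ q))
      (trans (difference {a = evalB β p} {evalB β q} (evalB-++ β p (scaleB -1ℤ q)) (evalB-scaleB β -1ℤ q))
        (ℤₚ.i≡j⇒i-j≡0 {evalB β p} {evalB β q} (hyp β)))) k)))
  where
  difference : ∀ {s a b t} → s ≡ a + t → t ≡ -1ℤ * b → s ≡ a - b
  difference {s} {a} {b} refl refl = ring a b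
    where
    ring : ∀ a b → a + -1ℤ * b ≡ a - b
    ring = solve-∀

-- The recursion at x = (1,1,...)

raiseB : BPoly → BPoly
raiseB = map (λ t → proj₁ t , suc (proj₂ t))

evalB-raiseB : ∀ β p → evalB β (raiseB p) ≡ β * evalB β p
evalB-raiseB β []            = sym (ℤₚ.*-zeroʳ β)
evalB-raiseB β ((c , e) ∷ p) = trans (cong (_+_ (c * (β * β ℤ.^ e))) (evalB-raiseB β p)) (ring β c (β ℤ.^ e) (evalB β p))
  where
  ring : ∀ β c b p → c * (β * b) + β * p ≡ β * (c * b + p)
  ring = solve-∀

shiftᶜ : (ℕ → ℤ) → ℕ → ℤ
shiftᶜ a zero    = 0ℤ
shiftᶜ a (suc k) = a k

coeffB-raiseB : ∀ k p → coeffB k (raiseB p) ≡ shiftᶜ (λ j → coeffB j p) k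
coeffB-raiseB zero    []      = refl
coeffB-raiseB (suc k) []      = refl
coeffB-raiseB zero    (t ∷ p) = trans (coeffB-∷ zero (proj₁ t , suc (proj₂ t)) (raiseB p)) (trans (ℤₚ.+-identityˡ (coeffB 0 (raiseB p))) (coeffB-raiseB zero p))
coeffB-raiseB (suc k) (t ∷ p) = trans (coeffB-∷ (suc k) (proj₁ t , suc (proj₂ t)) (raiseB p)) (trans (cong (_+_ (pick k t)) (coeffB-raiseB (suc k) p)) (sym (coeffB-∷ k t p)))

-- Both scalars are β-polynomials and specialise x to (1,1,…).
formal : Scalars
formal = record
  { V = BPoly ; _⊕_ = _++_ ; 𝟘 = [] ; 𝟙 = (1ℤ , 0) ∷ []
  ; X = λ _ p → p ; Y = λ _ p → p ++ raiseB p }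

coefficients : Scalars
coefficients = record
  { V = ℕ → ℤ ; _⊕_ = λ a b k → a k + b k ; 𝟘 = λ _ → 0ℤ ; 𝟙 = λ k → pick k (1ℤ , 0)
  ; X = λ _ a → a ; Y = λ _ a k → a k + shiftᶜ a k }

module _ where
  open Related.Compatible

  AtOnes : ∀ β → BPoly → ((ℕ → ℤ) → ℤ) → Set
  AtOnes β p f = evalB β p ≡ f (λ _ → 1ℤ)

  at-ones : ∀ β i → Related.Compatible formal (functions β) (AtOnes β) i
  at-ones β i .⊕-rel {a = p} {a′ = q} s t = trans (evalB-++ β p q) (cong₂ _+_ s t)
  at-ones β i .𝟘-rel = refl
  at-ones β i .X-rel {b = f} _ s = trans s (sym (ℤₚ.*-identityˡ (f (λ _ → 1ℤ))))
  at-ones β i .Y-rel {a = p} {b = f} _ s = trans (evalB-++ β p (raiseB p))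
    (trans (cong (_+_ (evalB β p)) (evalB-raiseB β p))
    (trans (cong (λ t → t + β * t) s) (ring β (f (λ _ → 1ℤ)))))
    where
    ring : ∀ β t → t + β * t ≡ (1ℤ + β * 1ℤ) * t
    ring = solve-∀

  HasCoefficients : BPoly → (ℕ → ℤ) → Set
  HasCoefficients p a = ∀ k → coeffB k p ≡ a k

  has-coefficients : ∀ i → Related.Compatible formal coefficients HasCoefficients i
  has-coefficients i .⊕-rel {a = p} {a′ = q} s t k = trans (coeffB-++ k p q) (cong₂ _+_ (s k) (t k))
  has-coefficients i .𝟘-rel k = refl
  has-coefficients i .X-rel _ s = s
  has-coefficients i .Y-rel {a = p} {b = a} _ s k = trans (coeffB-++ k p (raiseB p))
    (cong₂ _+_ (s k) (trans (coeffB-raiseB k p) (shifted k)))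
    where
    shifted : ∀ k → shiftᶜ (λ j → coeffB j p) k ≡ shiftᶜ a k
    shifted zero    = refl
    shifted (suc k) = s k

module Coefficients = Slide coefficients

-- `formal` is the bridge: it can be evaluated at every β, which ties it to 𝔊, and it has
-- coefficients. A bare sequence in `coefficients` has no value at β.
coeffB-Upsilon : ∀ N k w → Unique w → All (Within k N) w →
  ∀ c → coeffB c (Upsilon w) ≡ Coefficients.value N k (reverse w) c
coeffB-Upsilon N k w u ws c = trans
  (coeffB-unique (Upsilon w) formal-value (λ β → trans (eval-evalOnes β (groth w))
    (trans (Groth.eval-groth β N k w u ws (λ _ → 1ℤ))
      (sym (Related.value-rel _ _ _ (at-ones β L) (trans (ℤₚ.+-identityʳ _) refl) N k (reverse w) (ℕₚ.n≤1+n L))))) c)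
  (Related.value-rel _ _ _ (has-coefficients L) unit N k (reverse w) (ℕₚ.n≤1+n L) c)
  where
  L : ℕ
  L = length (reverse w)
  formal-value : BPoly
  formal-value = Slide.value formal N k (reverse w)
  unit : HasCoefficients ((1ℤ , 0) ∷ []) (λ j → pick j (1ℤ , 0))
  unit j = trans (coeffB-∷ j (1ℤ , 0) []) (ℤₚ.+-identityʳ (pick j (1ℤ , 0)))

-- Invariance under standardisation

SameOrder : (ℕ → ℕ) → Word → Set
SameOrder f w = ∀ {x y} → x ∈ w → y ∈ w → (f x <ᵇ f y) ≡ (x <ᵇ y)

swapAt-↭ : ∀ i w → swapAt i w ↭ w
swapAt-↭ zero    []          = ↭-refl
swapAt-↭ zero    (x ∷ [])    = ↭-refl
swapAt-↭ zero    (x ∷ y ∷ w) = swap y x ↭-refl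
swapAt-↭ (suc i) []          = ↭-refl
swapAt-↭ (suc i) (x ∷ w)     = prep x (swapAt-↭ i w)

swapAt-map : ∀ f i w → swapAt i (map f w) ≡ map f (swapAt i w)
swapAt-map f zero    []          = refl
swapAt-map f zero    (x ∷ [])    = refl
swapAt-map f zero    (x ∷ y ∷ w) = refl
swapAt-map f (suc i) []          = refl
swapAt-map f (suc i) (x ∷ w)     = cong (f x ∷_) (swapAt-map f i w)

firstAscent-map : ∀ f w → SameOrder f w → firstAscent (map f w) ≡ firstAscent w
firstAscent-map f []          same = refl
firstAscent-map f (x ∷ [])    same = refl
firstAscent-map f (x ∷ y ∷ w) same = cong₂ (λ b m → if b then just 0 else m)
  (same (here refl) (there (here refl)))
  (cong (Maybe.map suc) (firstAscent-map f (y ∷ w) (λ a b → same (there a) (there b))))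

grothFuel-map : ∀ f n k w → SameOrder f w → grothFuel n k (map f w) ≡ grothFuel n k w
grothFuel-map f n zero    w same = refl
grothFuel-map f n (suc k) w same rewrite firstAscent-map f w same with firstAscent w
... | nothing = refl
... | just i rewrite swapAt-map f i w =
  cong (piOp i) (grothFuel-map f n k (swapAt i w)
    (λ a b → same (∈-resp-↭ (swapAt-↭ i w) a) (∈-resp-↭ (swapAt-↭ i w) b)))

groth-map : ∀ f w → SameOrder f w → groth (map f w) ≡ groth w
groth-map f w same rewrite Listₚ.length-map f w = grothFuel-map f (length w) (length w ℕ.* length w) w same

below : Word → ℕ → ℕ
below w x = length (filter (_<? x) w)

below-mono : ∀ w {x y} → x ℕ.≤ y → below w x ℕ.≤ below w y
below-mono []      x≤y = ℕ.z≤n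
below-mono (a ∷ w) {x} {y} x≤y with a <? x | a <? y
... | yes a<x | yes a<y rewrite Listₚ.filter-accept (_<? x) {a} {w} a<x | Listₚ.filter-accept (_<? y) {a} {w} a<y = ℕ.s≤s (below-mono w x≤y)
... | yes a<x | no a≮y = ⊥-elim (a≮y (ℕₚ.<-≤-trans a<x x≤y))
... | no a≮x | yes a<y rewrite Listₚ.filter-reject (_<? x) {a} {w} a≮x | Listₚ.filter-accept (_<? y) {a} {w} a<y = ℕₚ.m≤n⇒m≤1+n (below-mono w x≤y)
... | no a≮x | no a≮y rewrite Listₚ.filter-reject (_<? x) {a} {w} a≮x | Listₚ.filter-reject (_<? y) {a} {w} a≮y = below-mono w x≤y

below-strict : ∀ w {x y} → x ∈ w → x < y → below w x < below w y
below-strict (a ∷ w) {x} {y} (here refl) x<y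
  rewrite Listₚ.filter-reject (_<? x) {x} {w} (ℕₚ.<-irrefl refl) | Listₚ.filter-accept (_<? y) {x} {w} x<y = ℕ.s≤s (below-mono w (ℕₚ.<⇒≤ x<y))
below-strict (a ∷ w) {x} {y} (there x∈w) x<y with a <? x | a <? y
... | yes a<x | yes a<y rewrite Listₚ.filter-accept (_<? x) {a} {w} a<x | Listₚ.filter-accept (_<? y) {a} {w} a<y = ℕ.s≤s (below-strict w x∈w x<y)
... | yes a<x | no a≮y = ⊥-elim (a≮y (ℕₚ.<-trans a<x x<y))
... | no a≮x | yes a<y rewrite Listₚ.filter-reject (_<? x) {a} {w} a≮x | Listₚ.filter-accept (_<? y) {a} {w} a<y = ℕₚ.m≤n⇒m≤1+n (below-strict w x∈w x<y)
... | no a≮x | no a≮y rewrite Listₚ.filter-reject (_<? x) {a} {w} a≮x | Listₚ.filter-reject (_<? y) {a} {w} a≮y = below-strict w x∈w x<y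

perm-sameOrder : ∀ w → SameOrder (suc ∘ below w) w
perm-sameOrder w {x} {y} x∈w y∈w with x <ᵇ y in eq
... | true  = Equivalence.to T-≡ (ℕₚ.<⇒<ᵇ (ℕ.s≤s (below-strict w x∈w (ℕₚ.<ᵇ⇒< x y (Equivalence.from T-≡ eq)))))
... | false with suc (below w x) <ᵇ suc (below w y) in eq′
...   | false = refl
...   | true  = ⊥-elim (ℕₚ.<⇒≱ (ℕₚ.<ᵇ⇒< (suc (below w x)) (suc (below w y)) (Equivalence.from T-≡ eq′))
                  (ℕ.s≤s (below-mono w (≮ᵇ⇒≥ eq))))

groth-perm : ∀ w → groth (perm w) ≡ groth w
groth-perm w = groth-map (suc ∘ below w) w (perm-sameOrder w)

perm-1423 : ∀ {a b c d} → a < c → c < d → d < b → perm (a ∷ b ∷ c ∷ d ∷ []) ≡ 1 ∷ 4 ∷ 2 ∷ 3 ∷ []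
perm-1423 {a} {b} {c} {d} a<c c<d d<b
  rewrite dec-false (a <? a) (ℕₚ.<-irrefl refl) | dec-true (a <? b) (ℕₚ.<-trans (ℕₚ.<-trans a<c c<d) d<b)
        | dec-true (a <? c) a<c | dec-true (a <? d) (ℕₚ.<-trans a<c c<d)
        | dec-false (b <? a) (ℕₚ.<⇒≯ (ℕₚ.<-trans (ℕₚ.<-trans a<c c<d) d<b)) | dec-false (b <? b) (ℕₚ.<-irrefl refl)
        | dec-false (b <? c) (ℕₚ.<⇒≯ (ℕₚ.<-trans c<d d<b)) | dec-false (b <? d) (ℕₚ.<⇒≯ d<b)
        | dec-false (c <? a) (ℕₚ.<⇒≯ a<c) | dec-true (c <? b) (ℕₚ.<-trans c<d d<b)
        | dec-false (c <? c) (ℕₚ.<-irrefl refl) | dec-true (c <? d) c<d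
        | dec-false (d <? a) (ℕₚ.<⇒≯ (ℕₚ.<-trans a<c c<d)) | dec-true (d <? b) d<b
        | dec-false (d <? c) (ℕₚ.<⇒≯ c<d) | dec-false (d <? d) (ℕₚ.<-irrefl refl)
  = refl

-- Words with struck letters

data Letter : Set where
  kept struck : ℕ → Letter

letter : Letter → ℕ
letter (kept x)   = x
letter (struck x) = x

Marked : Set
Marked = List Letter

infixr 5 _⊳_
_⊳_ : Letter → (Word → ℕ → ℤ) → Word → ℕ → ℤ
(kept x   ⊳ K) v   = K (x ∷ v)
(struck x ⊳ K) v c = K (x ∷ v) c - K v c

-- The linear extension of K, where a struck letter x stands for the formal difference x − ∅.
ext : (Word → ℕ → ℤ) → Marked → ℕ → ℤ
ext K []      = K []
ext K (l ∷ z) = ext (l ⊳ K) z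

ext-cong-⊆ : ∀ {K K′ : Word → ℕ → ℤ} {c} z → (∀ v → v ⊆ map letter z → K v c ≡ K′ v c) → ext K z c ≡ ext K′ z c
ext-cong-⊆ []             eq = eq [] []
ext-cong-⊆ (kept x ∷ z)   eq = ext-cong-⊆ z (λ v v⊆z → eq (x ∷ v) (refl ∷ v⊆z))
ext-cong-⊆ (struck x ∷ z) eq = ext-cong-⊆ z (λ v v⊆z → cong₂ _-_ (eq (x ∷ v) (refl ∷ v⊆z)) (eq v (x ∷ʳ v⊆z)))

ext-cong : ∀ {P : ℕ → Set} {K K′ : Word → ℕ → ℤ} {c} → (∀ v → All P v → K v c ≡ K′ v c) →
  ∀ z → All (P ∘ letter) z → ext K z c ≡ ext K′ z c
ext-cong eq z ps = ext-cong-⊆ z (λ v v⊆z → eq v (⊆ₚ.All-resp-⊆ v⊆z (Allₚ.map⁺ ps)))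

ext-cong′ : ∀ {K K′ : Word → ℕ → ℤ} {c} → (∀ v → K v c ≡ K′ v c) → ∀ z → ext K z c ≡ ext K′ z c
ext-cong′ eq z = ext-cong {P = λ _ → ⊤} (λ v _ → eq v) z (All.universal (λ _ → tt) z)

ext-+ : ∀ K K′ z c → ext (λ v c → K v c + K′ v c) z c ≡ ext K z c + ext K′ z c
ext-+ K K′ []             c = refl
ext-+ K K′ (kept x ∷ z)   c = ext-+ (kept x ⊳ K) (kept x ⊳ K′) z c
ext-+ K K′ (struck x ∷ z) c = trans
  (ext-cong′ (λ v → ring (K (x ∷ v) c) (K′ (x ∷ v) c) (K v c) (K′ v c)) z)
  (ext-+ (struck x ⊳ K) (struck x ⊳ K′) z c)
  where
  ring : ∀ a b d e → (a + b) - (d + e) ≡ (a - d) + (b - e)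
  ring = solve-∀

ext-minus : ∀ K K′ z c → ext (λ v c → K v c - K′ v c) z c ≡ ext K z c - ext K′ z c
ext-minus K K′ []             c = refl
ext-minus K K′ (kept x ∷ z)   c = ext-minus (kept x ⊳ K) (kept x ⊳ K′) z c
ext-minus K K′ (struck x ∷ z) c = trans
  (ext-cong′ (λ v → ring (K (x ∷ v) c) (K′ (x ∷ v) c) (K v c) (K′ v c)) z)
  (ext-minus (struck x ⊳ K) (struck x ⊳ K′) z c)
  where
  ring : ∀ a b d e → (a - b) - (d - e) ≡ (a - d) - (b - e)
  ring = solve-∀

-- A struck letter turns a constant into f - f, so the result is `f c` or 0.
ext-const : ∀ z {f : ℕ → ℤ} {c} → + 0 ℤ.≤ f c → + 0 ℤ.≤ ext (λ _ → f) z c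
ext-const []             0≤f = 0≤f
ext-const (kept x ∷ z)   0≤f = ext-const z 0≤f
ext-const (struck x ∷ z) {f} {c} 0≤f =
  subst (+ 0 ℤ.≤_) (ext-cong′ (λ _ → sym (ℤₚ.+-inverseʳ (f c))) z) (ext-const z {λ _ → 0ℤ} ℤₚ.≤-refl)

shiftᶜ-cong : ∀ {a b : ℕ → ℤ} → (∀ c → a c ≡ b c) → ∀ c → shiftᶜ a c ≡ shiftᶜ b c
shiftᶜ-cong eq zero    = refl
shiftᶜ-cong eq (suc c) = eq c

ext-shiftᶜ : ∀ K z c → ext (λ v → shiftᶜ (K v)) z c ≡ shiftᶜ (ext K z) c
ext-shiftᶜ K []             c       = refl
ext-shiftᶜ K (kept x ∷ z)   c       = ext-shiftᶜ (kept x ⊳ K) z c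
ext-shiftᶜ K (struck x ∷ z) c       = trans (ext-cong′ (λ v → pointwise v c) z) (ext-shiftᶜ (struck x ⊳ K) z c)
  where
  pointwise : ∀ v c → shiftᶜ (K (x ∷ v)) c - shiftᶜ (K v) c ≡ shiftᶜ ((struck x ⊳ K) v) c
  pointwise v zero    = refl
  pointwise v (suc c) = refl

-- Scanning words with struck letters

-- slide at x = (1,1,…) restricted to the letters to the right of the least letter.
sweep : (Word → ℕ → ℤ) → ℕ → Word → ℕ → ℤ
sweep K h []      = K (h ∷ [])
sweep K h (o ∷ z) =
  if does (o <? h)
    then sweep (K ∘ (h ∷_)) o z
    else λ c → sweep (K ∘ (o ∷_)) h z c + (sweep (K ∘ (h ∷_)) o z c + shiftᶜ (sweep (K ∘ (h ∷_)) o z) c)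

sweeps : (Word → ℕ → ℤ) → Word → ℕ → ℤ
sweeps K []      = K []
sweeps K (h ∷ z) = sweep K h z

sweep-< : ∀ K {h o} z → o < h → sweep K h (o ∷ z) ≡ sweep (K ∘ (h ∷_)) o z
sweep-< K {h} {o} z o<h rewrite dec-true (o <? h) o<h = refl

sweep-≮ : ∀ K {h o} z → ¬ (o < h) → ∀ c → sweep K h (o ∷ z) c ≡
  sweep (K ∘ (o ∷_)) h z c + (sweep (K ∘ (h ∷_)) o z c + shiftᶜ (sweep (K ∘ (h ∷_)) o z) c)
sweep-≮ K {h} {o} z o≮h c rewrite dec-false (o <? h) o≮h = refl

sweep-minus : ∀ K K′ h z c →
  sweep (λ v c → K v c - K′ v c) h z c ≡ sweep K h z c - sweep K′ h z c
sweep-minus K K′ h []      c = refl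
sweep-minus K K′ h (o ∷ z) c with o <? h
... | yes o<h rewrite sweep-< K z o<h | sweep-< K′ z o<h | sweep-< (λ v c → K v c - K′ v c) z o<h =
  sweep-minus (K ∘ (h ∷_)) (K′ ∘ (h ∷_)) o z c
... | no o≮h = trans (sweep-≮ (λ v c → K v c - K′ v c) z o≮h c)
  (trans (cong₂ _+_ (sweep-minus (K ∘ (o ∷_)) (K′ ∘ (o ∷_)) h z c)
           (cong₂ _+_ (sweep-minus (K ∘ (h ∷_)) (K′ ∘ (h ∷_)) o z c) (shifted c)))
  (trans (ring (sweep (K ∘ (o ∷_)) h z c) (sweep (K′ ∘ (o ∷_)) h z c)
               (sweep (K ∘ (h ∷_)) o z c) (sweep (K′ ∘ (h ∷_)) o z c)
               (shiftᶜ (sweep (K ∘ (h ∷_)) o z) c) (shiftᶜ (sweep (K′ ∘ (h ∷_)) o z) c))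
    (sym (cong₂ _-_ (sweep-≮ K z o≮h c) (sweep-≮ K′ z o≮h c)))))
  where
  ring : ∀ a b d e f g → (a - b) + ((d - e) + (f - g)) ≡ (a + (d + f)) - (b + (e + g))
  ring = solve-∀
  shifted : ∀ c → shiftᶜ (sweep (λ v c → K (h ∷ v) c - K′ (h ∷ v) c) o z) c ≡
    shiftᶜ (sweep (K ∘ (h ∷_)) o z) c - shiftᶜ (sweep (K′ ∘ (h ∷_)) o z) c
  shifted zero    = refl
  shifted (suc c) = sweep-minus (K ∘ (h ∷_)) (K′ ∘ (h ∷_)) o z c

sweeps-minus : ∀ K K′ z c →
  sweeps (λ v c → K v c - K′ v c) z c ≡ sweeps K z c - sweeps K′ z c
sweeps-minus K K′ []      c = refl
sweeps-minus K K′ (h ∷ z) c = sweep-minus K K′ h z c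

-- Linearity of the scan in its continuation; `z` will be the part left of the least letter, which
-- no scan of `g` touches.
sweeps-ext : ∀ (G : Word → Word → ℕ → ℤ) z g c →
  ext (λ a → sweeps (λ v → G v a) g) z c ≡ sweeps (λ v → ext (G v) z) g c
sweeps-ext G []             g c = refl
sweeps-ext G (kept x ∷ z)   g c = sweeps-ext (λ v → kept x ⊳ G v) z g c
sweeps-ext G (struck x ∷ z) g c = trans
  (ext-cong′ (λ a → sym (sweeps-minus (λ v → G v (x ∷ a)) (λ v → G v a) g c)) z)
  (sweeps-ext (λ v → struck x ⊳ G v) z g c)

-- The third summand of `sweeps-cross` subtracts a term in which `l` is released although a struck
-- `l′` is deleted. The left side has no such term, and `surplus` restores it.
surplus : Letter → (Word → ℕ → ℤ) → Word → ℕ → ℤ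
surplus (kept _)   K v c = 0ℤ
surplus (struck _) K v c = sweeps K v c

-- In order: `l′` is passed; the β-part of the exchange; its constant part, where both marks
-- survive; the correction. Terms with `l` deleted start the scan at `l′` and all lie in the third
-- summand, so `l` counts as kept in the others.
sweeps-cross : ∀ K l l′ v c → ¬ (letter l′ < letter l) →
  (l′ ⊳ l ⊳ sweeps K) v c ≡
    (sweep (l′ ⊳ K) (letter l) v c + shiftᶜ (sweep (K ∘ (letter l ∷_)) (letter l′) v) c)
    + ((l′ ⊳ sweeps (l ⊳ K)) v c + surplus l′ (K ∘ (letter l ∷_)) v c)
sweeps-cross K (kept h) (kept o) v c o≮h = trans (sweep-≮ K v o≮h c)
  (ring (sweep (K ∘ (o ∷_)) h v c) (sweep (K ∘ (h ∷_)) o v c) (shiftᶜ (sweep (K ∘ (h ∷_)) o v) c))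
  where
  ring : ∀ a b s → a + (b + s) ≡ (a + s) + (b + 0ℤ)
  ring = solve-∀
sweeps-cross K (kept h) (struck o) v c o≮h
  rewrite sweep-≮ K v o≮h c | sweep-minus (K ∘ (o ∷_)) K h v c =
  ring (sweep (K ∘ (o ∷_)) h v c) (sweep (K ∘ (h ∷_)) o v c) (shiftᶜ (sweep (K ∘ (h ∷_)) o v) c)
       (sweep K h v c) (sweeps (K ∘ (h ∷_)) v c)
  where
  ring : ∀ a b s d e → (a + (b + s)) - d ≡ ((a - d) + s) + ((b - e) + e)
  ring = solve-∀
sweeps-cross K (struck h) (kept o) v c o≮h
  rewrite sweep-≮ K v o≮h c | sweep-minus (K ∘ (h ∷_)) K o v c =
  ring (sweep (K ∘ (o ∷_)) h v c) (sweep (K ∘ (h ∷_)) o v c) (shiftᶜ (sweep (K ∘ (h ∷_)) o v) c) (sweep K o v c)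
  where
  ring : ∀ a b s d → (a + (b + s)) - d ≡ (a + s) + ((b - d) + 0ℤ)
  ring = solve-∀
sweeps-cross K (struck h) (struck o) v c o≮h
  rewrite sweep-≮ K v o≮h c | sweep-minus (K ∘ (o ∷_)) K h v c
        | sweep-minus (K ∘ (h ∷_)) K o v c | sweeps-minus (K ∘ (h ∷_)) K v c =
  ring (sweep (K ∘ (o ∷_)) h v c) (sweep (K ∘ (h ∷_)) o v c) (shiftᶜ (sweep (K ∘ (h ∷_)) o v) c)
       (sweep K h v c) (sweep K o v c) (sweeps (K ∘ (h ∷_)) v c) (sweeps K v c)
  where
  ring : ∀ a b s d e f g → ((a + (b + s)) - e) - (d - g) ≡ ((a - d) + s) + (((b - e) - (f - g)) + f)
  ring = solve-∀

HeadBelow : ℕ → Word → Set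
HeadBelow h []      = ⊤
HeadBelow h (a ∷ v) = a < h

sweep-below : ∀ K {h} v → HeadBelow h v → sweep K h v ≡ sweeps (K ∘ (h ∷_)) v
sweep-below K []      _   = refl
sweep-below K (a ∷ v) a<h = sweep-< K v a<h

sweeps-below : ∀ K l v c → HeadBelow (letter l) v → (l ⊳ sweeps K) v c ≡ sweeps (l ⊳ K) v c
sweeps-below K (kept h)   v c b = cong (λ f → f c) (sweep-below K v b)
sweeps-below K (struck h) v c b = trans (cong (λ f → f c - sweeps K v c) (sweep-below K v b))
  (sym (sweeps-minus (K ∘ (h ∷_)) K v c))

headBelow : ∀ {h v} → All (_< h) v → HeadBelow h v
headBelow []      = tt
headBelow (p ∷ _) = p

-- Moves and the excess inequality

-- No 312 with z as the 2 and a struck 1, where γ is the part of the word to the left of z, reversed.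
Over : ℕ → Marked → Set
Over z []             = ⊤
Over z (kept x ∷ γ)   = Over z γ
Over z (struck x ∷ γ) = (x < z → All (λ l → letter l < z) γ) × Over z γ

No312 : Marked → Set
No312 []      = ⊤
No312 (l ∷ γ) = Over (letter l) γ × No312 γ

over-tail : ∀ {z} l {γ} → Over z (l ∷ γ) → Over z γ
over-tail (kept _)   o = o
over-tail (struck _) o = proj₂ o

-- Deleting a struck `l′` exposes a letter of γ to `l`. By `Over` that letter is smaller as well, so
-- `l` is released in every term.
ext-sweeps-below : ∀ K l l′ γ c → letter l′ < letter l → Over (letter l) (l′ ∷ γ) →
  ext (l ⊳ sweeps K) (l′ ∷ γ) c ≡ ext (sweeps (l ⊳ K)) (l′ ∷ γ) c
ext-sweeps-below K l (kept o)   γ c o<h _ =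
  ext-cong′ (λ v → sweeps-below K l (o ∷ v) c o<h) γ
ext-sweeps-below K l (struck o) γ c o<h (below , _) =
  ext-cong (λ v v<h → cong₂ _-_ (sweeps-below K l (o ∷ v) c o<h) (sweeps-below K l v c (headBelow v<h))) γ (below o<h)

-- All words produced from a marked word by the recursion are reached by these moves.
infix 4 _⇝_
data _⇝_ : Marked → Marked → Set where
  done : ∀ {z} → z ⇝ z
  _◅_  : ∀ {x y z} → x ⇝ y → y ⇝ z → x ⇝ z
  keep : ∀ {x z} → struck x ∷ z ⇝ kept x ∷ z
  drop : ∀ {l z} → l ∷ z ⇝ z
  pass : ∀ {h l z} → ¬ (letter l < h) → kept h ∷ l ∷ z ⇝ l ∷ kept h ∷ z
  under : ∀ {l z z′} → z ⇝ z′ → l ∷ z ⇝ l ∷ z′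

keep-letter : ∀ l {z} → l ∷ z ⇝ kept (letter l) ∷ z
keep-letter (kept x)   = done
keep-letter (struck x) = keep

-- Quantified over all moves so that it passes to the continuations met in `excess`.
Good : (Word → ℕ → ℤ) → Marked → Set
Good K z = ∀ {δ} → z ⇝ δ → ∀ c → + 0 ℤ.≤ ext K δ c

-- When `l′` exceeds `l`, the constant part of the exchange dominates the unscanned word by
-- induction. The other summands are 0 or come from sweeps of words reached by moves, hence are
-- nonnegative.
excess : ∀ K l γ → No312 (l ∷ γ) → Good K (l ∷ γ) → ∀ c → ext K (l ∷ γ) c ℤ.≤ ext (sweeps K) (l ∷ γ) c
excess-any : ∀ K γ → No312 γ → Good K γ → ∀ c → ext K γ c ℤ.≤ ext (sweeps K) γ c
nonneg-any : ∀ K γ → No312 γ → Good K γ → ∀ c → + 0 ℤ.≤ ext (sweeps K) γ c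

nonneg : ∀ K l γ → No312 (l ∷ γ) → Good K (l ∷ γ) → ∀ c → + 0 ℤ.≤ ext (sweeps K) (l ∷ γ) c
nonneg K l γ n g c = ℤₚ.≤-trans (g done c) (excess K l γ n g c)

excess-any K []      n g c = ℤₚ.≤-refl
excess-any K (l ∷ γ) n g c = excess K l γ n g c

nonneg-any K γ n g c = ℤₚ.≤-trans (g done c) (excess-any K γ n g c)

excess K (kept h)   [] _ _ c = ℤₚ.≤-refl
excess K (struck h) [] _ _ c = ℤₚ.≤-refl
excess K l (l′ ∷ γ) (over , over′ , n) g c with letter l′ <? letter l
... | yes o<h = ℤₚ.≤-trans (excess (l ⊳ K) l′ γ (over′ , n) (g ∘ under) c)
                  (ℤₚ.≤-reflexive (sym (ext-sweeps-below K l l′ γ c o<h over)))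
... | no o≮h = ℤₚ.≤-trans base (ℤₚ.≤-reflexive (sym expand))
  where
  h o : ℕ
  h = letter l
  o = letter l′
  over-h : Over h γ
  over-h = over-tail l′ over
  A B C D : ℕ → ℤ
  A = ext (sweep (l′ ⊳ K) h) γ
  B = ext (sweep (K ∘ (h ∷_)) o) γ
  C = ext (sweeps (l ⊳ K)) (l′ ∷ γ)
  D = ext (surplus l′ (K ∘ (h ∷_))) γ
  expand : ext (sweeps K) (l ∷ l′ ∷ γ) c ≡ (A c + shiftᶜ B c) + (C c + D c)
  expand = trans (ext-cong′ (λ v → sweeps-cross K l l′ v c o≮h) γ)
    (trans (ext-+ (λ v c → sweep (l′ ⊳ K) h v c + shiftᶜ (sweep (K ∘ (h ∷_)) o v) c)
                  (λ v c → (l′ ⊳ sweeps (l ⊳ K)) v c + surplus l′ (K ∘ (h ∷_)) v c) γ c)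
      (cong₂ _+_ (trans (ext-+ (sweep (l′ ⊳ K) h) (λ v → shiftᶜ (sweep (K ∘ (h ∷_)) o v)) γ c)
                   (cong (_+_ (A c)) (ext-shiftᶜ (sweep (K ∘ (h ∷_)) o) γ c)))
                 (ext-+ (l′ ⊳ sweeps (l ⊳ K)) (surplus l′ (K ∘ (h ∷_))) γ c)))
  A≥0 : + 0 ℤ.≤ A c
  A≥0 = nonneg (l′ ⊳ K) (kept h) γ (over-h , n) (λ s → g ((keep-letter l ◅ pass o≮h) ◅ under s)) c
  B≥0 : ∀ c → + 0 ℤ.≤ B c
  B≥0 = nonneg (K ∘ (h ∷_)) (kept o) γ (over′ , n) (λ s → g (keep-letter l ◅ under (keep-letter l′ ◅ s)))
  shiftB≥0 : ∀ c → + 0 ℤ.≤ shiftᶜ B c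
  shiftB≥0 zero    = ℤₚ.≤-refl
  shiftB≥0 (suc c) = B≥0 c
  surplus≥0 : ∀ l′ → + 0 ℤ.≤ ext (surplus l′ (K ∘ (h ∷_))) γ c
  surplus≥0 (kept _)   = ext-const γ {λ _ → 0ℤ} ℤₚ.≤-refl
  surplus≥0 (struck _) = nonneg-any (K ∘ (h ∷_)) γ n (λ s → g (keep-letter l ◅ under (drop ◅ s))) c
  base : ext (l ⊳ K) (l′ ∷ γ) c ℤ.≤ (A c + shiftᶜ B c) + (C c + D c)
  base = ℤₚ.≤-trans (excess (l ⊳ K) l′ γ (over′ , n) (g ∘ under) c)
    (ℤₚ.≤-trans (ℤₚ.≤-reflexive (ring (C c)))
      (ℤₚ.+-mono-≤ (ℤₚ.+-mono-≤ A≥0 (shiftB≥0 c)) (ℤₚ.+-monoʳ-≤ (C c) (surplus≥0 l′))))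
    where
    ring : ∀ x → x ≡ (0ℤ + 0ℤ) + (x + 0ℤ)
    ring = solve-∀

-- Moves preserve distinctness and pattern avoidance

open Coefficients

All-⇝ : ∀ {P : ℕ → Set} {γ δ} → γ ⇝ δ → All (P ∘ letter) γ → All (P ∘ letter) δ
All-⇝ done      p             = p
All-⇝ {P} (s ◅ s′) p          = All-⇝ {P} s′ (All-⇝ {P} s p)
All-⇝ keep      (p ∷ ps)      = p ∷ ps
All-⇝ drop      (p ∷ ps)      = ps
All-⇝ (pass _)  (p ∷ p′ ∷ ps) = p′ ∷ p ∷ ps
All-⇝ {P} (under s) (p ∷ ps)  = p ∷ All-⇝ {P} s ps

Distinct : Marked → Set
Distinct = AllPairs (λ l l′ → letter l ≢ letter l′)

Distinct-⇝ : ∀ {γ δ} → γ ⇝ δ → Distinct γ → Distinct δ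
Distinct-⇝ done      d                    = d
Distinct-⇝ (s ◅ s′)  d                    = Distinct-⇝ s′ (Distinct-⇝ s d)
Distinct-⇝ keep      (p ∷ d)              = p ∷ d
Distinct-⇝ drop      (p ∷ d)              = d
Distinct-⇝ (pass _)  ((q ∷ p) ∷ p′ ∷ d)   = ((q ∘ sym) ∷ p′) ∷ p ∷ d
Distinct-⇝ (under {l} s) (p ∷ d)          = All-⇝ {letter l ≢_} s p ∷ Distinct-⇝ s d

⇝-++ : ∀ {γ δ} C → γ ⇝ δ → γ ++ C ⇝ δ ++ C
⇝-++ C done      = done
⇝-++ C (s ◅ s′)  = ⇝-++ C s ◅ ⇝-++ C s′
⇝-++ C keep      = keep
⇝-++ C drop      = drop
⇝-++ C (pass p)  = pass p
⇝-++ C (under s) = under (⇝-++ C s)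

drop-middle : ∀ δ l α → δ ++ l ∷ α ⇝ δ ++ α
drop-middle []      l α = drop
drop-middle (e ∷ δ) l α = under (drop-middle δ l α)

-- No 1423 with a struck 2; the pattern reads 3 2 4 1 because the word is reversed.
Avoids : Marked → Set
Avoids w = ∀ {c x b a} → letter a < x → x < letter c → letter c < letter b → ¬ (c ∷ struck x ∷ b ∷ a ∷ [] ⊑ w)

avoids-⊑ : ∀ {v w} → v ⊑ w → Avoids w → Avoids v
avoids-⊑ v⊑w av p q r s = av p q r (⊆-trans s v⊑w)

insert-⊑ : ∀ {A : Set} (xs : List A) y ys → xs ++ ys ⊑ xs ++ y ∷ ys
insert-⊑ []       y ys = y ∷ʳ ⊆-refl
insert-⊑ (x ∷ xs) y ys = refl ∷ insert-⊑ xs y ys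

⊑-swap : ∀ {A : Set} {s : List A} xs {a b} {ys} → s ⊑ xs ++ b ∷ a ∷ ys →
  s ⊑ xs ++ a ∷ b ∷ ys ⊎ (∃[ s₁ ] ∃[ s₂ ] (s ≡ s₁ ++ b ∷ a ∷ s₂ × s₁ ⊑ xs × s₂ ⊑ ys))
⊑-swap []       (b ∷ʳ (a ∷ʳ p))    = inj₁ (a ∷ʳ (b ∷ʳ p))
⊑-swap []       (b ∷ʳ (refl ∷ p))  = inj₁ (refl ∷ (b ∷ʳ p))
⊑-swap []       (refl ∷ (a ∷ʳ p))  = inj₁ (a ∷ʳ (refl ∷ p))
⊑-swap []       (refl ∷ (refl ∷ p)) = inj₂ ([] , _ , refl , [] , p)
⊑-swap (x ∷ xs) (x ∷ʳ p) with ⊑-swap xs p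
... | inj₁ q = inj₁ (x ∷ʳ q)
... | inj₂ (s₁ , s₂ , eq , p₁ , p₂) = inj₂ (s₁ , s₂ , eq , x ∷ʳ p₁ , p₂)
⊑-swap (x ∷ xs) (refl ∷ p) with ⊑-swap xs p
... | inj₁ q = inj₁ (refl ∷ q)
... | inj₂ (s₁ , s₂ , eq , p₁ , p₂) = inj₂ (x ∷ s₁ , s₂ , cong (x ∷_) eq , refl ∷ p₁ , p₂)

-- The 2 of the pattern is struck, so it is not the letter just kept; the other three matter through
-- their values only.
⊑-keep : ∀ {c x b a y} xs {ys} → c ∷ struck x ∷ b ∷ a ∷ [] ⊑ xs ++ kept y ∷ ys →
  ∃[ c′ ] ∃[ b′ ] ∃[ a′ ] (letter c′ ≡ letter c × letter b′ ≡ letter b × letter a′ ≡ letter a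
    × c′ ∷ struck x ∷ b′ ∷ a′ ∷ [] ⊑ xs ++ struck y ∷ ys)
⊑-keep {c} {x} {b} {a} {y} xs {ys} p = pattern-of (unkeep xs p)
  where
  data Lift : Letter → Letter → Set where
    same : ∀ {l} → Lift l l
    mark : Lift (kept y) (struck y)
  data Lifts : Marked → Marked → Set where
    []  : Lifts [] []
    _∷_ : ∀ {l l′ s s′} → Lift l l′ → Lifts s s′ → Lifts (l ∷ s) (l′ ∷ s′)
  lifts-refl : ∀ s → Lifts s s
  lifts-refl []      = []
  lifts-refl (l ∷ s) = same ∷ lifts-refl s
  lift-letter : ∀ {l l′} → Lift l l′ → letter l′ ≡ letter l
  lift-letter same = refl
  lift-letter mark = refl
  unkeep : ∀ xs {s} → s ⊑ xs ++ kept y ∷ ys → ∃[ s′ ] (Lifts s s′ × s′ ⊑ xs ++ struck y ∷ ys)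
  unkeep []       (_ ∷ʳ p)   = _ , lifts-refl _ , _ ∷ʳ p
  unkeep []       (refl ∷ p) = _ , mark ∷ lifts-refl _ , refl ∷ p
  unkeep (e ∷ xs) (_ ∷ʳ p) with unkeep xs p
  ... | s′ , L , q = s′ , L , e ∷ʳ q
  unkeep (e ∷ xs) (refl ∷ p) with unkeep xs p
  ... | s′ , L , q = e ∷ s′ , same ∷ L , refl ∷ q
  pattern-of : ∃[ s′ ] (Lifts (c ∷ struck x ∷ b ∷ a ∷ []) s′ × s′ ⊑ xs ++ struck y ∷ ys) → _
  pattern-of (c′ ∷ _ ∷ b′ ∷ a′ ∷ [] , (lc ∷ same ∷ lb ∷ la ∷ []) , q) =
    c′ , b′ , a′ , lift-letter lc , lift-letter lb , lift-letter la , q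

-- A 1423 created by pass has the two exchanged letters as its 4 and 1, and before the exchange the least
-- letter l could play the 1.
avoids-⇝ : ∀ xs {γ δ} l α → γ ⇝ δ → All (λ e → letter l < letter e) γ →
  Avoids (xs ++ γ ++ l ∷ α) → Avoids (xs ++ δ ++ l ∷ α)
avoids-⇝ xs l α done      _ av = av
avoids-⇝ xs l α (s ◅ s′)  m av = avoids-⇝ xs l α s′ (All-⇝ {letter l <_} s m) (avoids-⇝ xs l α s m av)
avoids-⇝ xs l α keep      _ av {c} {x} {b} {a} p q r s with ⊑-keep xs s
... | c′ , b′ , a′ , ec , eb , ea , s′ =
  av {c′} {x} {b′} {a′} (subst (_< x) (sym ea) p) (subst (x <_) (sym ec) q) (subst₂ _<_ (sym ec) (sym eb) r) s′
avoids-⇝ xs l α (drop {e} {γ}) _ av = avoids-⊑ (insert-⊑ xs e (γ ++ l ∷ α)) av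
avoids-⇝ xs l α (pass {h} {o} {γ} o≮h) (l<h ∷ _) av {c} {x} {b} {a} p q r s with ⊑-swap xs s
... | inj₁ s′ = av p q r s′
... | inj₂ (_ ∷ [] , _ , refl , _ , _) = o≮h (ℕₚ.<-trans q r)
... | inj₂ (_ ∷ _ ∷ [] , _ , refl , p₁ , _) =
  av {c} {x} {b} {l} (ℕₚ.<-trans l<h p) q r
    (⊆ₚ.++⁺ p₁ (kept h ∷ʳ (refl ∷ (⊆ₚ.++⁺ (minimum γ) (refl ∷ minimum α)))))
... | inj₂ (_ ∷ _ ∷ _ ∷ _ ∷ [] , _ , () , _ , _)
... | inj₂ (_ ∷ _ ∷ _ ∷ _ ∷ _ ∷ _ , _ , () , _ , _)
avoids-⇝ xs l α (under {e} {γ} {δ} s) (_ ∷ m) av =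
  subst Avoids (Listₚ.++-assoc xs (e ∷ []) (δ ++ l ∷ α))
    (avoids-⇝ (xs ++ e ∷ []) l α s m (subst Avoids (sym (Listₚ.++-assoc xs (e ∷ []) (γ ++ l ∷ α))) av))

Avoids312 : Marked → Set
Avoids312 γ = ∀ {c x b} → x < letter c → letter c < letter b → ¬ (c ∷ struck x ∷ b ∷ [] ⊑ γ)

avoids-312 : ∀ γ l α → All (λ e → letter l < letter e) γ → Avoids (γ ++ l ∷ α) → Avoids312 γ
avoids-312 γ l α m av {c} {x} {b} p q s =
  av {c} {x} {b} {l} (All.lookup m (Sublist.lookup s (there (here refl)))) p q (⊆ₚ.++⁺ s (refl ∷ minimum α))

over : ∀ z γ → All (λ e → z ≢ letter e) γ →
  (∀ {x b} → x < z → z < letter b → ¬ (struck x ∷ b ∷ [] ⊑ γ)) → Over z γ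
over z []             _        _  = tt
over z (kept x ∷ γ)   (_ ∷ z≢) av = over z γ z≢ (λ p q s → av p q (_ ∷ʳ s))
over z (struck x ∷ γ) (_ ∷ z≢) av =
  (λ x<z → All.tabulate (λ {b} b∈γ → ℕₚ.≤∧≢⇒<
    (ℕₚ.≮⇒≥ (λ z<b → av x<z z<b (refl ∷ from∈ b∈γ))) (λ b≡z → All.lookup z≢ b∈γ (sym b≡z))))
  , over z γ z≢ (λ p q s → av p q (_ ∷ʳ s))

no312 : ∀ γ → Distinct γ → Avoids312 γ → No312 γ
no312 []      _        _  = tt
no312 (l ∷ γ) (l≢ ∷ d) av = over (letter l) γ l≢ (λ p q s → av p q (refl ∷ s)) , no312 γ d (λ p q s → av p q (_ ∷ʳ s))

-- Removing the least letter, and nonnegativity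

ext-++ : ∀ F γ δ c → ext F (γ ++ δ) c ≡ ext (λ g → ext (λ a → F (g ++ a)) δ) γ c
ext-++ F []             δ c = refl
ext-++ F (kept x ∷ γ)   δ c = ext-++ (kept x ⊳ F) γ δ c
ext-++ F (struck x ∷ γ) δ c = trans (ext-++ (struck x ⊳ F) γ δ c)
  (ext-cong′ (λ g → ext-minus (λ a → F (x ∷ g ++ a)) (λ a → F (g ++ a)) δ c) γ)

Vanishesᶜ : (ℕ → ℤ) → (ℕ → ℤ) → Set
Vanishesᶜ a _ = ∀ c → a c ≡ 0ℤ

vanishesᶜ-compatible : ∀ i → Related.Compatible coefficients coefficients Vanishesᶜ i
vanishesᶜ-compatible i .Related.Compatible.⊕-rel p q c = cong₂ _+_ (p c) (q c)
vanishesᶜ-compatible i .Related.Compatible.𝟘-rel c = refl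
vanishesᶜ-compatible i .Related.Compatible.X-rel _ p = p
vanishesᶜ-compatible i .Related.Compatible.Y-rel {a = a} _ p c = cong₂ _+_ (p c) (shifted c)
  where
  shifted : ∀ c → shiftᶜ a c ≡ 0ℤ
  shifted zero    = refl
  shifted (suc c) = p c

slideᶜ-absent : ∀ k K h z → k ∉ h ∷ z → ∀ c → slide k K h z c ≡ 0ℤ
slideᶜ-absent k K h z k∉ = Related.slide-rel _ _ Vanishesᶜ (vanishesᶜ-compatible (length z)) k K K h z ℕₚ.≤-refl
  (λ z′ ρ → ⊥-elim (k∉ (∈-resp-↭ ρ (here refl))))

All<⇒∉ : ∀ {k z} → All (k <_) z → k ∉ z
All<⇒∉ k< k∈ = ℕₚ.<-irrefl refl (All.lookup k< k∈)

slideᶜ-min : ∀ k K z → All (k <_) z → ∀ c → slide k K k z c ≡ K z c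
slideᶜ-min k K []      _           c rewrite dec-true (k ≟ k) refl = refl
slideᶜ-min k K (o ∷ z) (k<o ∷ k<z) c rewrite slide-≮ k K z (ℕₚ.<⇒≯ k<o) =
  trans (cong₂ _+_ (slideᶜ-min k (K ∘ (o ∷_)) z k<z c) (cong₂ _+_ (absent c) (shifted c)))
        (ℤₚ.+-identityʳ (K (o ∷ z) c))
  where
  absent : ∀ c → slide k (K ∘ (k ∷_)) o z c ≡ 0ℤ
  absent = slideᶜ-absent k (K ∘ (k ∷_)) o z (All<⇒∉ (k<o ∷ k<z))
  shifted : ∀ c → shiftᶜ (slide k (K ∘ (k ∷_)) o z) c ≡ 0ℤ
  shifted zero    = refl
  shifted (suc c) = absent c

-- Meeting the smaller `k` forces the held letter out. Beyond `k`, only passing every letter keeps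
-- `k` held, with weight 1 here, so `a` stays in place.
slide-sweep : ∀ k K h g a → All (k <_) (h ∷ g) → All (k <_) a → ∀ c →
  slide k K h (g ++ k ∷ a) c ≡ sweep (λ v → K (v ++ a)) h g c
slide-sweep k K h [] a (k<h ∷ _) k<a c rewrite slide-< k K a k<h = slideᶜ-min k (K ∘ (h ∷_)) a k<a c
slide-sweep k K h (o ∷ g) a (k<h ∷ k<o ∷ k<g) k<a c with o <? h
... | yes o<h rewrite slide-< k K (g ++ k ∷ a) o<h | sweep-< (λ v → K (v ++ a)) g o<h =
  slide-sweep k (K ∘ (h ∷_)) o g a (k<o ∷ k<g) k<a c
... | no o≮h rewrite slide-≮ k K (g ++ k ∷ a) o≮h = trans
  (cong₂ _+_ (slide-sweep k (K ∘ (o ∷_)) h g a (k<h ∷ k<g) k<a c)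
    (cong₂ _+_ (ih c) (shiftᶜ-cong ih c)))
  (sym (sweep-≮ (λ v → K (v ++ a)) g o≮h c))
  where
  ih : ∀ c → slide k (K ∘ (h ∷_)) o (g ++ k ∷ a) c ≡ sweep (λ v → K (h ∷ v ++ a)) o g c
  ih = slide-sweep k (K ∘ (h ∷_)) o g a (k<o ∷ k<g) k<a

value-sweeps : ∀ n k g a → All (k <_) g → All (k <_) a → ∀ c →
  value (suc n) k (g ++ k ∷ a) c ≡ sweeps (λ v → value n (suc k) (v ++ a)) g c
value-sweeps n k []      a k<g k<a c rewrite value-∈ n {k} {k ∷ a} (here refl) = slideᶜ-min k (value n (suc k)) a k<a c
value-sweeps n k (h ∷ g) a k<g k<a c rewrite value-∈ n {k} {h ∷ g ++ k ∷ a} (there (∈-++⁺ʳ g (here refl))) = slide-sweep k (value n (suc k)) h g a k<g k<a c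

split-at : ∀ {k} w → k ∈ map letter w → ∃[ γ ] ∃[ l ] ∃[ α ] (w ≡ γ ++ l ∷ α × letter l ≡ k)
split-at (l ∷ w) (here refl) = [] , l , w , refl , refl
split-at (l ∷ w) (there k∈) with split-at w k∈
... | γ , l′ , α , refl , refl = l ∷ γ , l′ , α , refl , refl

distinct-middle : ∀ γ {l α} → Distinct (γ ++ l ∷ α) →
  Distinct γ × All (λ e → letter l ≢ letter e) γ × All (λ e → letter l ≢ letter e) α
distinct-middle []      (l≢ ∷ _) = [] , [] , l≢
distinct-middle (e ∷ γ) (e≢ ∷ d) with distinct-middle γ d | Allₚ.++⁻ γ e≢
... | dγ , l≢γ , l≢α | e≢γ , (e≢l ∷ _) = e≢γ ∷ dγ , (e≢l ∘ sym) ∷ l≢γ , l≢α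

strictly : ∀ {k} {w : Marked} → All (λ e → k ≢ letter e) w → All (λ e → k ℕ.≤ letter e) w → All (λ e → k < letter e) w
strictly []         []         = []
strictly (k≢ ∷ k≢s) (k≤ ∷ k≤s) = ℕₚ.≤∧≢⇒< k≤ k≢ ∷ strictly k≢s k≤s

value-nonneg : ∀ n k w → Avoids w → Distinct w → All (λ e → k ℕ.≤ letter e) w →
  ∀ c → + 0 ℤ.≤ ext (value n k) w c
value-nonneg zero k w _ _ _ c = ext-const w (0≤pick c)
  where
  0≤pick : ∀ c → + 0 ℤ.≤ pick c (1ℤ , 0)
  0≤pick zero    = ℤ.+≤+ ℕ.z≤n
  0≤pick (suc c) = ℤ.+≤+ ℕ.z≤n
value-nonneg (suc n) k w av d k≤ c with k ∈? map letter w
... | no k∉ = subst (+ 0 ℤ.≤_)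
    (ext-cong {P = k ≢_} (λ v k≢v → cong (λ f → f c) (sym (value-∉ n (λ k∈v → All.lookup k≢v k∈v refl)))) w k≢)
    (value-nonneg n (suc k) w av d (strictly k≢ k≤) c)
  where
  k≢ : All (λ e → k ≢ letter e) w
  k≢ = Allₚ.map⁻ {P = k ≢_} {f = letter} (All.tabulate λ { e∈ refl → k∉ e∈ })
... | yes k∈ with split-at w k∈
...   | γ , l , α , refl , refl = at l refl
  where
  k₀ : ℕ
  k₀ = letter l
  dm = distinct-middle γ d
  k<γ : All (λ e → k₀ < letter e) γ
  k<γ = strictly (proj₁ (proj₂ dm)) (Allₚ.++⁻ˡ γ k≤)
  k<α : All (λ e → k₀ < letter e) α
  k<α = strictly (proj₂ (proj₂ dm)) (All.tail (Allₚ.++⁻ʳ γ k≤))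
  F′ F K : Word → ℕ → ℤ
  F′ = value n (suc k₀)
  F  = value (suc n) k₀
  K g = ext (λ a → F′ (g ++ a)) α
  good : Good K γ
  -- The moves are followed with `l` still present, as `avoids-⇝` needs it to play the 1; it is
  -- dropped afterwards.
  good {δ} s c′ = subst (+ 0 ℤ.≤_) (ext-++ F′ δ α c′)
    (value-nonneg n (suc k₀) (δ ++ α)
      (avoids-⊑ (insert-⊑ δ l α) (avoids-⇝ [] l α s k<γ av))
      (Distinct-⇝ (⇝-++ (l ∷ α) s ◅ drop-middle δ l α) d)
      (Allₚ.++⁺ (All-⇝ {k₀ <_} s k<γ) k<α) c′)
  no-312 : No312 γ
  no-312 = no312 γ (proj₁ dm) (avoids-312 γ l α k<γ av)
  with-k : ext (λ g → ext (λ a → F (g ++ k₀ ∷ a)) α) γ c ≡ ext (sweeps K) γ c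
  with-k = ext-cong {P = k₀ <_} (λ g k<g → trans
    (ext-cong {P = k₀ <_} (λ a k<a → value-sweeps n k₀ g a k<g k<a c) α k<α)
    (sweeps-ext (λ v a → F′ (v ++ a)) α g c)) γ k<γ
  without-k : ext (λ g → ext (λ a → F (g ++ a)) α) γ c ≡ ext K γ c
  without-k = ext-cong {P = k₀ <_} (λ g k<g →
    ext-cong {P = k₀ <_} (λ a k<a → cong (λ f → f c) (value-∉ n (All<⇒∉ (Allₚ.++⁺ k<g k<a)))) α k<α) γ k<γ
  -- The letter is abstracted so that its two forms can be told apart while the local definitions
  -- still refer to `l`.
  at : ∀ l′ → l′ ≡ l → + 0 ℤ.≤ ext F (γ ++ l′ ∷ α) c
  at (kept _)   refl = subst (+ 0 ℤ.≤_) (sym (trans (ext-++ F γ (l ∷ α) c) with-k)) (nonneg-any K γ no-312 good c)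
  at (struck _) refl = subst (+ 0 ℤ.≤_)
    (sym (trans (ext-++ F γ (l ∷ α) c)
         (trans (ext-cong′ (λ g → ext-minus (λ a → F (g ++ k₀ ∷ a)) (λ a → F (g ++ a)) α c) γ)
         (trans (ext-minus (λ g → ext (λ a → F (g ++ k₀ ∷ a)) α) (λ g → ext (λ a → F (g ++ a)) α) γ c)
                (cong₂ _-_ with-k without-k)))))
    (ℤₚ.i≤j⇒0≤j-i (excess-any K γ no-312 good c))

-- The alternating sum as a word with struck letters

mark : ∀ {u w} → u ⊆ w → Marked
mark []                 = []
mark (y ∷ʳ p)           = struck y ∷ mark p
mark (_∷_ {x = x} _ p)  = kept x ∷ mark p

letters-mark : ∀ {u w} (p : u ⊆ w) → map letter (mark p) ≡ w
letters-mark []         = refl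
letters-mark (y ∷ʳ p)   = cong (y ∷_) (letters-mark p)
letters-mark (refl ∷ p) = cong (_ ∷_) (letters-mark p)

subwords-∷ : ∀ x w → subwords (x ∷ w) ≡ map (x ∷_) (subwords w) ++ subwords w
subwords-∷ x w = trans (Listₚ.map-++ (λ m → select m (x ∷ w)) (map (true ∷_) ms) (map (false ∷_) ms))
  (cong₂ _++_ (trans (sym (Listₚ.map-∘ ms)) (Listₚ.map-∘ ms)) (sym (Listₚ.map-∘ ms)))
  where
  ms : List (List Bool)
  ms = masks (length w)

subwords-⊆ : ∀ w → All (_⊆ w) (subwords w)
subwords-⊆ []      = [] ∷ []
subwords-⊆ (x ∷ w) rewrite subwords-∷ x w =
  Allₚ.++⁺ (Allₚ.map⁺ (All.map (refl ∷_) (subwords-⊆ w))) (All.map (x ∷ʳ_) (subwords-⊆ w))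

total : (Word → ℤ) → List Word → ℤ
total G []       = 0ℤ
total G (v ∷ vs) = G v + total G vs

total-++ : ∀ G vs vs′ → total G (vs ++ vs′) ≡ total G vs + total G vs′
total-++ G []       vs′ = sym (ℤₚ.+-identityˡ (total G vs′))
total-++ G (v ∷ vs) vs′ = trans (cong (_+_ (G v)) (total-++ G vs vs′)) (sym (ℤₚ.+-assoc (G v) (total G vs) (total G vs′)))

total-map : ∀ G (f : Word → Word) vs → total G (map f vs) ≡ total (G ∘ f) vs
total-map G f []       = refl
total-map G f (v ∷ vs) = cong (_+_ (G (f v))) (total-map G f vs)

total-cong : ∀ {P : Word → Set} {G G′} → (∀ v → P v → G v ≡ G′ v) → ∀ {vs} → All P vs → total G vs ≡ total G′ vs
total-cong eq []       = refl
total-cong eq (p ∷ ps) = cong₂ _+_ (eq _ p) (total-cong eq ps)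

total-neg : ∀ G vs → total (λ v → - G v) vs ≡ - total G vs
total-neg G []       = refl
total-neg G (v ∷ vs) = trans (cong (_+_ (- G v)) (total-neg G vs)) (sym (ℤₚ.neg-distrib-+ (G v) (total G vs)))

total-0 : ∀ vs → total (λ _ → 0ℤ) vs ≡ 0ℤ
total-0 []       = refl
total-0 (v ∷ vs) = trans (ℤₚ.+-identityˡ (total (λ _ → 0ℤ) vs)) (total-0 vs)

coeffB-concatMap : ∀ c (G : Word → BPoly) vs → coeffB c (concatMap G vs) ≡ total (coeffB c ∘ G) vs
coeffB-concatMap c G []       = refl
coeffB-concatMap c G (v ∷ vs) = trans (coeffB-++ c (G v) (concatMap G vs)) (cong (_+_ (coeffB c (G v))) (coeffB-concatMap c G vs))

summand : (Word → ℕ → ℤ) → Word → ℕ → ℕ → Word → ℤ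
summand K u n c v = if does (u ⊆? v) then (-1ℤ ℤ.^ (n ∸ length v)) * K v c else 0ℤ

-- The length bound keeps the truncated subtraction in the exponent exact, so one more deleted
-- letter flips the sign.
summand-suc : ∀ K u {n} c {v} → length v ≤ n → summand K u (suc n) c v ≡ - summand K u n c v
summand-suc K u {n} c {v} v≤n with does (u ⊆? v)
... | false = refl
... | true rewrite ℕₚ.+-∸-assoc 1 v≤n = ring (-1ℤ ℤ.^ (n ∸ length v)) (K v c)
  where
  ring : ∀ a b → -1ℤ * a * b ≡ - (a * b)
  ring = solve-∀

∷ʳ⁻ : ∀ {y} {u v : Word} → y ∉ u → u ⊆ y ∷ v → u ⊆ v
∷ʳ⁻ y∉u (_ ∷ʳ q)   = q
∷ʳ⁻ y∉u (refl ∷ q) = ⊥-elim (y∉u (here refl))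

summand-cons : ∀ K u n c {y} v → y ∉ u → summand K u (suc n) c (y ∷ v) ≡ summand (kept y ⊳ K) u n c v
summand-cons K u n c {y} v y∉u rewrite does-⇔ (mk⇔ (∷ʳ⁻ y∉u) (y ∷ʳ_)) (u ⊆? (y ∷ v)) (u ⊆? v) = refl

summand-match : ∀ K u n c {y} v → summand K (y ∷ u) (suc n) c (y ∷ v) ≡ summand (kept y ⊳ K) u n c v
summand-match K u n c {y} v rewrite does-⇔ (mk⇔ ⊆ₚ.∷⁻ (refl ∷_)) ((y ∷ u) ⊆? (y ∷ v)) (u ⊆? v) = refl

summand-absent : ∀ K u n c {y w} v → y ∉ w → v ⊆ w → summand K (y ∷ u) n c v ≡ 0ℤ
summand-absent K u n c {y} {w} v y∉w v⊆w
  rewrite dec-false ((y ∷ u) ⊆? v) (λ s → y∉w (Sublist.lookup (⊆-trans s v⊆w) (here refl))) = refl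

-- Expanding each struck y as y - ∅ gives one sign per deleted letter. As the letters are distinct,
-- a subword contains `u` exactly when no kept letter is deleted.
total-summand : ∀ K {u w} (p : u ⊆ w) → Unique w → ∀ c →
  total (summand K u (length w) c) (subwords w) ≡ ext K (mark p) c
total-summand K [] _ c = ring (K [] c)
  where
  ring : ∀ a → 1ℤ * a + 0ℤ ≡ a
  ring = solve-∀
total-summand K {u} {y ∷ w} (y ∷ʳ p) (y≢ ∷ uw) c
  rewrite subwords-∷ y w
        | total-++ (summand K u (suc (length w)) c) (map (y ∷_) (subwords w)) (subwords w)
        | total-map (summand K u (suc (length w)) c) (y ∷_) (subwords w) = trans
  (cong₂ _+_
    (trans (total-cong (λ v _ → summand-cons K u (length w) c v y∉u) (subwords-⊆ w))
           (total-summand (kept y ⊳ K) p uw c))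
    (trans (total-cong (λ v v⊆w → summand-suc K u c {v} (⊆ₚ.length-mono-≤ v⊆w)) (subwords-⊆ w))
    (trans (total-neg (summand K u (length w) c) (subwords w)) (cong -_ (total-summand K p uw c)))))
  (sym (ext-minus (kept y ⊳ K) K (mark p) c))
  where
  y∉u : y ∉ u
  y∉u y∈u = All.lookup y≢ (Sublist.lookup p y∈u) refl
total-summand K {y ∷ u} {y ∷ w} (refl ∷ p) (y≢ ∷ uw) c
  rewrite subwords-∷ y w
        | total-++ (summand K (y ∷ u) (suc (length w)) c) (map (y ∷_) (subwords w)) (subwords w)
        | total-map (summand K (y ∷ u) (suc (length w)) c) (y ∷_) (subwords w) = trans
  (cong₂ _+_
    (trans (total-cong (λ v _ → summand-match K u (length w) c v) (subwords-⊆ w))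
           (total-summand (kept y ⊳ K) p uw c))
    (trans (total-cong (λ v v⊆w → summand-absent K u (suc (length w)) c v (λ y∈w → All.lookup y≢ y∈w refl) v⊆w) (subwords-⊆ w))
           (total-0 (subwords w))))
  (ℤₚ.+-identityʳ (ext (kept y ⊳ K) (mark p) c))

coeffB-altSum : ∀ {u w} (p : u ⊆ w) → Unique w → ∀ c →
  coeffB c (altSum u w) ≡ ext (λ v c → coeffB c (Upsilon (perm v))) (mark p) c
coeffB-altSum {u} {w} p uw c = trans (coeffB-concatMap c _ (subwords w))
  (trans (total-cong (λ v _ → coefficient v) (subwords-⊆ w))
    (total-summand (λ v c → coeffB c (Upsilon (perm v))) p uw c))
  where
  coefficient : ∀ v → coeffB c (if does (u ⊆? v) then scaleB (-1ℤ ℤ.^ (length w ∸ length v)) (Upsilon (perm v)) else [])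
    ≡ summand (λ v c → coeffB c (Upsilon (perm v))) u (length w) c v
  coefficient v with does (u ⊆? v)
  ... | true  = coeffB-scaleB c (-1ℤ ℤ.^ (length w ∸ length v)) (Upsilon (perm v))
  ... | false = refl

ext-reverse : ∀ F z c → ext (λ v → F (reverse v)) z c ≡ ext F (reverse z) c
ext-reverse F []      c = refl
ext-reverse F (l ∷ z) c rewrite Listₚ.unfold-reverse l z = trans (last l)
  (trans (ext-reverse (λ g → ext (λ a → F (g ++ a)) (l ∷ [])) z c) (sym (ext-++ F (reverse z) (l ∷ []) c)))
  where
  last : ∀ l → ext (l ⊳ (λ v → F (reverse v))) z c ≡ ext (λ v → ext (λ a → F (reverse v ++ a)) (l ∷ [])) z c
  last (kept x)   = ext-cong′ (λ v → cong (λ t → F t c) (Listₚ.unfold-reverse x v)) z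
  last (struck x) = ext-cong′ (λ v → cong₂ _-_ (cong (λ t → F t c) (Listₚ.unfold-reverse x v))
                                               (cong (λ t → F t c) (sym (Listₚ.++-identityʳ (reverse v))))) z

avoids-reverse : ∀ z → Avoids1423 (map letter z) → Avoids (reverse z)
avoids-reverse z av {c} {x} {b} {a} p q r s = av (letter a) (letter b) x (letter c)
  (subst (letter a ∷ letter b ∷ x ∷ letter c ∷ [] ⊆_)
    (trans (cong reverse (Listₚ.reverse-map letter z)) (Listₚ.reverse-involutive (map letter z)))
    (⊆ₚ.reverse⁺ (⊆ₚ.map⁺ letter s)))
  (perm-1423 p q r)

distinct-reverse : ∀ z → Unique (map letter z) → Distinct (reverse z)
distinct-reverse z u = AllPairsₚ.map⁻ (subst Unique (sym (Listₚ.reverse-map letter z))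
  (unique-resp-↭ (↭-sym (↭-reverse (map letter z))) u))

unique-resp-⊆ : ∀ {v w : Word} → v ⊆ w → Unique w → Unique v
unique-resp-⊆ []         []       = []
unique-resp-⊆ (_ ∷ʳ p)   (_ ∷ u)  = unique-resp-⊆ p u
unique-resp-⊆ (refl ∷ p) (x≢ ∷ u) = ⊆ₚ.All-resp-⊆ p x≢ ∷ unique-resp-⊆ p u

perm-unique : ∀ n {w} → IsPerm n w → Unique w
perm-unique n p = unique-resp-↭ (↭-sym p) (Uniqueₚ.map⁺ ℕₚ.suc-injective (Uniqueₚ.upTo⁺ n))

perm-within : ∀ n {w} → IsPerm n w → All (Within 0 (suc n)) w
perm-within n p = All-resp-↭ (↭-sym p) (Allₚ.map⁺ (Allₚ.applyUpTo⁺₁ (λ i → i) n (λ i<n → ℕ.z≤n , ℕ.s≤s i<n)))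

theorem1p5 : (n : ℕ) (w u : Word) → IsPerm n w → Avoids1423 w → u ≤w w →
    NonNegCoeffs (altSum u w)
theorem1p5 n w u w-perm av u⊆w c = subst (+ 0 ℤ.≤_) (sym expansion)
  -- The letters 1, ..., n lie in [0, n+1). Starting at 0 makes the lower bound trivial and costs
  -- one round that removes nothing.
  (value-nonneg (suc n) 0 (reverse z) (avoids-reverse z (subst Avoids1423 (sym w≡) av))
    (distinct-reverse z (subst Unique (sym w≡) w-unique)) (All.universal (λ _ → ℕ.z≤n) (reverse z)) c)
  where
  z : Marked
  z = mark u⊆w
  w≡ : map letter z ≡ w
  w≡ = letters-mark u⊆w
  w-unique : Unique w
  w-unique = perm-unique n w-perm
  F : Word → ℕ → ℤ
  F = Coefficients.value (suc n) 0
  expansion : coeffB c (altSum u w) ≡ ext F (reverse z) c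
  expansion = trans (coeffB-altSum u⊆w w-unique c)
    (trans (ext-cong-⊆ z (λ v v⊆ → let v⊆w = subst (v ⊆_) w≡ v⊆ in
              trans (cong (λ g → coeffB c (evalOnes g)) (groth-perm v))
                (coeffB-Upsilon (suc n) 0 v (unique-resp-⊆ v⊆w w-unique) (⊆ₚ.All-resp-⊆ v⊆w (perm-within n w-perm)) c)))
      (ext-reverse F z c))
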